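{- There is an absolute constant $C>0$ such that for all integers $w\ge 2$ and $t\ge 2$ there exists a worker-task assignment function for $w$ workers and $t$ tasks whose switching cost is at most $C\log w\,\log(wt)$.
   Context: Let $w,t$ be positive integers. A task multiset is a multiset $T$ of size $|T|=w$ whose elements lie in $[t]=\{1,\dots,t\}$ (multiplicities may be arbitrary); write $m_T(j)$ for the multiplicity of $j$ in $T$. A worker-task assignment function $\phi$ assigns to every task multiset $T$ an assignment of the workers $[w]=\{1,\dots,w\}$ to tasks, i.e. a map $\phi(T):[w]\to[t]$ such that for each task $j$ exactly $m_T(j)$ workers are mapped to $j$. (It depends only on $T$.) Two task multisets $T_1,T_2$ of size $w$ are adjacent if $|T_1\setminus T_2|=|T_2\setminus T_1|=1$ (multiset difference: $m_{A\setminus B}(i)=\max(0,m_A(i)-m_B(i))$). The switching cost between adjacent $T_1,T_2$ is the number of workers $i\in[w]$ with $\phi(T_1)(i)\ne\phi(T_2)(i)$; the switching cost of $\phi$ is the maximum of this quantity over all pairs of adjacent task multisets. -}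

module Defs where

open import Data.Nat using (ℕ; zero; suc; _+_; _∸_; _≤_)
open import Data.Fin using (Fin; zero; suc; _≟_)
open import Data.Product using (Σ; _×_; _,_; proj₁)
open import Relation.Nullary using (Dec; yes; no; ¬_)
open import Relation.Binary.PropositionalEquality using (_≡_)

sumFin : (n : ℕ) → (Fin n → ℕ) → ℕ
sumFin zero    f = 0
sumFin (suc n) f = f zero + sumFin n (λ i → f (suc i))

countFin : (n : ℕ) → {P : Fin n → Set} → ((i : Fin n) → Dec (P i)) → ℕ
countFin n P? = sumFin n (λ i → indicator (P? i))
  where
  indicator : {A : Set} → Dec A → ℕ
  indicator (yes _) = 1
  indicator (no _)  = 0

TaskMultiset : (w t : ℕ) → Set
TaskMultiset w t = Σ (Fin t → ℕ) (λ m → sumFin t m ≡ w)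

mult : {w t : ℕ} → TaskMultiset w t → Fin t → ℕ
mult T = proj₁ T

diffSize : {w t : ℕ} → TaskMultiset w t → TaskMultiset w t → ℕ
diffSize {t = t} A B = sumFin t (λ j → mult A j ∸ mult B j)

Adjacent : {w t : ℕ} → TaskMultiset w t → TaskMultiset w t → Set
Adjacent A B = (diffSize A B ≡ 1) × (diffSize B A ≡ 1)

Assignment : {w t : ℕ} → TaskMultiset w t → Set
Assignment {w} {t} T =
  Σ (Fin w → Fin t) (λ f → (j : Fin t) → countFin w (λ i → f i ≟ j) ≡ mult T j)

WTAFunction : (w t : ℕ) → Set
WTAFunction w t = (T : TaskMultiset w t) → Assignment T

assign : {w t : ℕ} {T : TaskMultiset w t} → Assignment T → Fin w → Fin t
assign A = proj₁ A

switches : {w t : ℕ} → WTAFunction w t → TaskMultiset w t → TaskMultiset w t → ℕ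
switches {w} φ T₁ T₂ = countFin w (λ i → ¬? (assign {T = T₁} (φ T₁) i ≟ assign {T = T₂} (φ T₂) i))
  where open import Relation.Nullary.Decidable using (¬?)

SwitchingCostAtMost : {w t : ℕ} → WTAFunction w t → ℕ → Set
SwitchingCostAtMost {w} {t} φ c =
  (T₁ T₂ : TaskMultiset w t) → Adjacent T₁ T₂ → switches φ T₁ T₂ ≤ c

{-# OPTIONS --safe #-}
module Submission where

-- Workers and tickets (copies of tasks) are hashed to n bins, and every bin containing both
-- kinds matches its first worker with its first ticket. Inserting or deleting one element
-- changes at most one unmatched element and the partners of at most three, so a fixed
-- sequence of such rounds has switching cost linear in its length.
-- If at least n workers and n tickets are present, a random hash matches a constant fraction
-- of n outside an event of probability exponentially small in n: otherwise, apart from a few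
-- bins, the bins would be divided between workers and tickets, and a union bound over all
-- divisions applies. There are only (wt)^O(n) states with O(n) elements, so O(log (wt))
-- rounds, chosen greedily by averaging the potential Σ 4^(elements left) over the hash
-- functions, bring every such state below n elements of each kind. Halving n repeatedly,
-- O(log w) phases match everybody.

open import Defs
open import Data.Nat using (ℕ; zero; suc; _+_; _*_; _∸_; _^_; _≤_; _<_; _>_; z≤n; s≤s; _<ᵇ_; _≤?_; NonZero; >-nonZero)
open import Data.Nat.Properties hiding (_≟_; suc-injective)
import Data.Nat.Properties as ℕ
open import Data.Nat.ListAction using () renaming (sum to sumˡ)
open import Data.Nat.ListAction.Properties using (sum-++)
open import Data.Nat.Logarithm using (⌊log₂_⌋; ⌊log₂⌋-mono-≤; ⌊log₂[2^n]⌋≡n)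
open import Data.Nat.Tactic.RingSolver using (solve-∀)
open import Data.Fin using (Fin; zero; suc; _≟_; toℕ; fromℕ<; splitAt; _↑ˡ_; _↑ʳ_; combine; remQuot)
open import Data.Fin.Properties using (suc-injective; splitAt-↑ˡ; splitAt-↑ʳ; splitAt⁻¹-↑ˡ; splitAt⁻¹-↑ʳ; ↑ˡ-injective; ↑ʳ-injective; remQuot-combine; combine-remQuot; toℕ-injective; toℕ-fromℕ<)
open import Data.Bool using (Bool; true; false; _∧_; _∨_; not; if_then_else_)
open import Data.Bool.Properties using (∧-zeroʳ; ∧-identityʳ; ∧-comm; not-involutive; not-¬; ¬-not) renaming (_≟_ to _≟ᵇ_)
open import Data.List using (List; []; _∷_; _++_; length; map)
open import Data.List.Properties using (map-++; map-∘; length-++)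
open import Data.List.Membership.Propositional using (_∈_; _∉_)
open import Data.List.Membership.Propositional.Properties using (∈-++⁺ˡ; ∈-++⁺ʳ; ∈-map⁺)
open import Data.List.Relation.Unary.Any using (here; there)
open import Data.Maybe as Maybe using (Maybe; just; nothing; maybe; is-nothing; is-just; _<∣>_)
open import Data.Maybe.Properties using (just-injective)
open import Data.Product using (Σ; ∃; ∃₂; _×_; _,_; proj₁; proj₂)
open import Data.Sum using (_⊎_; inj₁; inj₂; [_,_]′)
open import Data.Vec.Functional using (tail) renaming (_∷_ to _◂_)
open import Function using (_∘_; const; Injective)
open import Relation.Nullary using (¬_; Dec; does; yes; no; contradiction)
open import Relation.Nullary.Decidable using (dec-true; dec-false; _×-dec_)
open import Relation.Binary.PropositionalEquality using (_≡_; _≢_; _≗_; refl; sym; trans; cong; cong₂; subst; subst₂; module ≡-Reasoning)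
open import Algebra.Properties.Semiring.Sum +-*-semiring using (sum; sum-cong-≗; ∑-distrib-+; ∑-comm; *-distribˡ-sum)
open import Algebra.Properties.CommutativeMonoid.Sum *-1-commutativeMonoid using () renaming (sum to ∏; sum-cong-≗ to ∏-cong; ∑-distrib-+ to ∏-distrib-*)

-- Stability compares two runs of the same rounds, so one sequence of rounds must serve all states
-- at once. With M elements in total, the states with at most 4n elements number about M^(4n).
-- Because the gain of a round is also an nth power, n cancels, and the number of rounds per phase
-- depends on M alone.
--
-- The gain needs no concentration inequality. Label every bin by the sides it may hold: both, only
-- workers, or only tickets. If k bins are labelled both, then p and q bins are open to the two
-- sides with p + q = n + k, and the chance that at least n elements of each side comply is at most
-- (pq/n²)^n ≤ 16^k / 4^n. A hash function that matches k bins complies with some labelling having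
-- exactly k labels "both", and it removes 2k elements, which divides 4^(elements left) by 16^k. The
-- two powers of 16 cancel, so each of the 3^n labellings contributes at most 4^(-n), and the
-- potential falls on average by the factor (3/4)^n.

-- Exponential inequalities in division-free form

^-distribʳ-* : ∀ a b n → (a * b) ^ n ≡ a ^ n * b ^ n
^-distribʳ-* a b zero    = refl
^-distribʳ-* a b (suc n) = trans (cong (a * b *_) (^-distribʳ-* a b n)) (interchange a b (a ^ n) (b ^ n))
  where
  interchange : ∀ a b c d → a * b * (c * d) ≡ a * c * (b * d)
  interchange = solve-∀

-- This is (1 + 1/N)^j (1 - j/N) ≤ 1 without division. Each factor is absorbed by (N + 1) d ≤ N (d +
-- 1), valid for d ≤ N.
bernoulli : ∀ N j {d} → j + d ≡ N → suc N ^ j * d ≤ N ^ j * N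
bernoulli N zero    refl = ≤-refl
bernoulli N (suc j) {d} eq = begin
  suc N * suc N ^ j * d     ≡⟨ rearrange N (suc N ^ j) d ⟩
  suc N ^ j * (d + N * d)   ≤⟨ *-monoʳ-≤ (suc N ^ j) (+-monoˡ-≤ (N * d) (≤-trans (m≤n+m d (suc j)) (≤-reflexive eq))) ⟩
  suc N ^ j * (N + N * d)   ≡⟨ factor N (suc N ^ j) d ⟩
  N * (suc N ^ j * suc d)   ≤⟨ *-monoʳ-≤ N (bernoulli N j (trans (+-suc j d) eq)) ⟩
  N * (N ^ j * N)           ≡⟨ *-assoc N (N ^ j) N ⟨
  N * N ^ j * N             ∎
  where
  open ≤-Reasoning
  rearrange : ∀ N x d → suc N * x * d ≡ x * (d + N * d)
  rearrange = solve-∀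
  factor : ∀ N x d → x * (N + N * d) ≡ N * (x * suc d)
  factor = solve-∀

suc^≤2*^ : ∀ m d → 0 < d → m ≤ d → suc (m + d) ^ m ≤ 2 * (m + d) ^ m
suc^≤2*^ m d 0<d m≤d = *-cancelʳ-≤ _ _ d {{>-nonZero 0<d}} (begin
  suc (m + d) ^ m * d       ≤⟨ bernoulli (m + d) m refl ⟩
  (m + d) ^ m * (m + d)     ≤⟨ *-monoʳ-≤ ((m + d) ^ m) (+-monoˡ-≤ d m≤d) ⟩
  (m + d) ^ m * (d + d)     ≡⟨ rearrange ((m + d) ^ m) d ⟩
  2 * (m + d) ^ m * d       ∎)
  where
  open ≤-Reasoning
  rearrange : ∀ x d → x * (d + d) ≡ 2 * x * d
  rearrange = solve-∀

-- At N = n `bernoulli` is vacuous, so the exponent is halved: N is at least twice n/2, each half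
-- costs a factor 2, and the square is 4. The halving is the reason for taking n to be a power of
-- two.
suc^≤4*^ : ∀ i k → suc (2 ^ i + k) ^ (2 ^ i) ≤ 4 * (2 ^ i + k) ^ (2 ^ i)
suc^≤4*^ zero k = begin
  (2 + k) * 1           ≤⟨ m≤m+n _ (2 + 3 * k) ⟩
  (2 + k) * 1 + (2 + 3 * k) ≡⟨ rearrange k ⟩
  4 * ((1 + k) * 1)     ∎
  where
  open ≤-Reasoning
  rearrange : ∀ k → (2 + k) * 1 + (2 + 3 * k) ≡ 4 * ((1 + k) * 1)
  rearrange = solve-∀
suc^≤4*^ (suc i) k = subst (λ e → suc e ^ (2 * m) ≤ 4 * e ^ (2 * m)) (assoc m k) (begin
  suc N ^ (2 * m)               ≡⟨ square (suc N) ⟩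
  suc N ^ m * suc N ^ m         ≤⟨ *-mono-≤ half half ⟩
  (2 * N ^ m) * (2 * N ^ m)     ≡⟨ rearrange (N ^ m) ⟩
  4 * (N ^ m * N ^ m)           ≡⟨ cong (4 *_) (square N) ⟨
  4 * N ^ (2 * m)               ∎)
  where
  open ≤-Reasoning
  m = 2 ^ i
  N = m + (m + k)
  half : suc N ^ m ≤ 2 * N ^ m
  half = suc^≤2*^ m (m + k) (≤-trans (m^n>0 2 i) (m≤m+n m k)) (m≤m+n m k)
  square : ∀ x → x ^ (2 * m) ≡ x ^ m * x ^ m
  square x = trans (cong (λ e → x ^ (m + e)) (+-identityʳ m)) (^-distribˡ-+-* x m m)
  assoc : ∀ m k → m + (m + k) ≡ 2 * m + k
  assoc = solve-∀
  rearrange : ∀ x → (2 * x) * (2 * x) ≡ 4 * (x * x)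
  rearrange = solve-∀

-- (1 + k/n)ⁿ ≤ 4ᵏ for n = 2ⁱ.
[n+k]^n≤4^k*n^n : ∀ i k → (2 ^ i + k) ^ (2 ^ i) ≤ 4 ^ k * (2 ^ i) ^ (2 ^ i)
[n+k]^n≤4^k*n^n i zero = ≤-reflexive (trans (cong (_^ (2 ^ i)) (+-identityʳ (2 ^ i))) (sym (+-identityʳ _)))
[n+k]^n≤4^k*n^n i (suc k) = begin
  (n + suc k) ^ n         ≡⟨ cong (_^ n) (+-suc n k) ⟩
  suc (n + k) ^ n         ≤⟨ suc^≤4*^ i k ⟩
  4 * (n + k) ^ n         ≤⟨ *-monoʳ-≤ 4 ([n+k]^n≤4^k*n^n i k) ⟩
  4 * (4 ^ k * n ^ n)     ≡⟨ *-assoc 4 (4 ^ k) (n ^ n) ⟨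
  4 * 4 ^ k * n ^ n       ∎
  where
  open ≤-Reasoning
  n = 2 ^ i

4pq≤[p+q]² : ∀ p q → 4 * (p * q) ≤ (p + q) * (p + q)
4pq≤[p+q]² p q with ≤-total p q
... | inj₁ p≤q with m≤n⇒∃[o]m+o≡n p≤q
...   | d , refl = ≤-trans (m≤m+n _ (d * d)) (≤-reflexive (rearrange p d))
  where
  rearrange : ∀ p d → 4 * (p * (p + d)) + d * d ≡ (p + (p + d)) * (p + (p + d))
  rearrange = solve-∀
4pq≤[p+q]² p q | inj₂ q≤p with m≤n⇒∃[o]m+o≡n q≤p
...   | d , refl = ≤-trans (m≤m+n _ (d * d)) (≤-reflexive (rearrange q d))
  where
  rearrange : ∀ q d → 4 * ((q + d) * q) + d * d ≡ (q + d + q) * (q + d + q)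
  rearrange = solve-∀

-- Since p/n ≤ 1, (p/n)^a ≤ (p/n)^n: more than n elements on a side only make compliance less
-- likely.
^-exchange : ∀ {n a p} → n ≤ a → p ≤ n → p ^ a * n ^ n ≤ n ^ a * p ^ n
^-exchange {n} {a} {p} n≤a p≤n with m≤n⇒∃[o]m+o≡n n≤a
... | d , refl = begin
  p ^ (n + d) * n ^ n         ≡⟨ cong (_* n ^ n) (^-distribˡ-+-* p n d) ⟩
  p ^ n * p ^ d * n ^ n       ≤⟨ *-monoˡ-≤ (n ^ n) (*-monoʳ-≤ (p ^ n) (^-monoˡ-≤ d p≤n)) ⟩
  p ^ n * n ^ d * n ^ n       ≡⟨ rearrange (p ^ n) (n ^ d) (n ^ n) ⟩
  n ^ n * n ^ d * p ^ n       ≡⟨ cong (_* p ^ n) (^-distribˡ-+-* n n d) ⟨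
  n ^ (n + d) * p ^ n         ∎
  where
  open ≤-Reasoning
  rearrange : ∀ x y z → x * y * z ≡ z * y * x
  rearrange = solve-∀

-- AM-GM bounds pq by ((n + k)/2)², and each of the two factors (1 + k/n)^n is at most 4^k. Hence
-- the 16 in `cost`.
4^n*p^n*q^n≤ : ∀ i {p q k} → p + q ≡ 2 ^ i + k →
               4 ^ (2 ^ i) * (p ^ (2 ^ i) * q ^ (2 ^ i)) ≤ 16 ^ k * ((2 ^ i) ^ (2 ^ i) * (2 ^ i) ^ (2 ^ i))
4^n*p^n*q^n≤ i {p} {q} {k} p+q≡ = begin
  4 ^ n * (p ^ n * q ^ n)                      ≡⟨ cong (4 ^ n *_) (^-distribʳ-* p q n) ⟨
  4 ^ n * (p * q) ^ n                          ≡⟨ ^-distribʳ-* 4 (p * q) n ⟨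
  (4 * (p * q)) ^ n                            ≤⟨ ^-monoˡ-≤ n (4pq≤[p+q]² p q) ⟩
  ((p + q) * (p + q)) ^ n                      ≡⟨ cong (λ e → (e * e) ^ n) p+q≡ ⟩
  ((n + k) * (n + k)) ^ n                      ≡⟨ ^-distribʳ-* (n + k) (n + k) n ⟩
  (n + k) ^ n * (n + k) ^ n                    ≤⟨ *-mono-≤ ([n+k]^n≤4^k*n^n i k) ([n+k]^n≤4^k*n^n i k) ⟩
  (4 ^ k * n ^ n) * (4 ^ k * n ^ n)            ≡⟨ rearrange (4 ^ k) (n ^ n) ⟩
  (4 ^ k * 4 ^ k) * (n ^ n * n ^ n)            ≡⟨ cong (_* (n ^ n * n ^ n)) (^-distribʳ-* 4 4 k) ⟨
  16 ^ k * (n ^ n * n ^ n)                     ∎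
  where
  open ≤-Reasoning
  n = 2 ^ i
  rearrange : ∀ x y → (x * y) * (x * y) ≡ (x * x) * (y * y)
  rearrange = solve-∀

-- P = N pᵃ qᵇ / nᵃ⁺ᵇ will be the number of hash functions, among all N, that send a workers
-- to p given bins and b tickets to q given bins, out of n = 2ⁱ.
compatible-bound : ∀ i {a b p q k N P} → 2 ^ i ≤ a → 2 ^ i ≤ b → p ≤ 2 ^ i → q ≤ 2 ^ i → p + q ≡ 2 ^ i + k →
                   P * ((2 ^ i) ^ a * (2 ^ i) ^ b) ≡ N * (p ^ a * q ^ b) →
                   4 ^ (2 ^ i) * P ≤ N * 16 ^ k
compatible-bound i {a} {b} {p} {q} {k} {N} {P} n≤a n≤b p≤n q≤n p+q≡ P≡ = *-cancelʳ-≤ _ _ (x * y * z) {{nonZero}} (begin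
  4 ^ n * P * (x * y * z)                          ≡⟨ r₁ (4 ^ n) P (x * y) z ⟩
  4 ^ n * (P * (x * y)) * z                        ≡⟨ cong (λ e → 4 ^ n * e * z) P≡ ⟩
  4 ^ n * (N * (p ^ a * q ^ b)) * (n ^ n * n ^ n)  ≡⟨ r₂ (4 ^ n) N (p ^ a) (q ^ b) (n ^ n) ⟩
  4 ^ n * N * ((p ^ a * n ^ n) * (q ^ b * n ^ n))  ≤⟨ *-monoʳ-≤ (4 ^ n * N) (*-mono-≤ (^-exchange n≤a p≤n) (^-exchange n≤b q≤n)) ⟩
  4 ^ n * N * ((x * p ^ n) * (y * q ^ n))          ≡⟨ r₃ (4 ^ n) N x (p ^ n) y (q ^ n) ⟩
  N * (x * y) * (4 ^ n * (p ^ n * q ^ n))          ≤⟨ *-monoʳ-≤ (N * (x * y)) (4^n*p^n*q^n≤ i p+q≡) ⟩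
  N * (x * y) * (16 ^ k * z)                       ≡⟨ r₄ N (x * y) (16 ^ k) z ⟩
  N * 16 ^ k * (x * y * z)                         ∎)
  where
  open ≤-Reasoning
  n = 2 ^ i
  x = n ^ a
  y = n ^ b
  z = n ^ n * n ^ n
  pow : ∀ e → NonZero (n ^ e)
  pow e = m^n≢0 n e {{m^n≢0 2 i}}
  nonZero : NonZero (x * y * z)
  nonZero = m*n≢0 (x * y) z {{m*n≢0 x y {{pow a}} {{pow b}}}} {{m*n≢0 _ _ {{pow n}} {{pow n}}}}
  r₁ : ∀ a b c d → a * b * (c * d) ≡ a * (b * c) * d
  r₁ = solve-∀
  r₂ : ∀ f N x y z → f * (N * (x * y)) * (z * z) ≡ f * N * ((x * z) * (y * z))
  r₂ = solve-∀
  r₃ : ∀ f N x u y v → f * N * ((x * u) * (y * v)) ≡ N * (x * y) * (f * (u * v))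
  r₃ = solve-∀
  r₄ : ∀ N x f z → N * x * (f * z) ≡ N * f * (x * z)
  r₄ = solve-∀

-- Sums and products over finite types

⟦_⟧ : Bool → ℕ
⟦ true ⟧  = 1
⟦ false ⟧ = 0

private variable
  m n : ℕ
  A B : Set

sumFin≡sum : ∀ n (f : Fin n → ℕ) → sumFin n f ≡ sum f
sumFin≡sum zero    f = refl
sumFin≡sum (suc n) f = cong (f zero +_) (sumFin≡sum n (tail f))

sum-mono : {f g : Fin n → ℕ} → (∀ i → f i ≤ g i) → sum f ≤ sum g
sum-mono {zero}  f≤g = z≤n
sum-mono {suc n} f≤g = +-mono-≤ (f≤g zero) (sum-mono (λ i → f≤g (suc i)))

sum-const : ∀ n (c : ℕ) → sum {n} (λ _ → c) ≡ n * c
sum-const zero    c = refl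
sum-const (suc n) c = cong (c +_) (sum-const n c)

term≤sum : (f : Fin n → ℕ) → ∀ i → f i ≤ sum f
term≤sum f zero    = m≤m+n _ _
term≤sum f (suc i) = ≤-trans (term≤sum (tail f) i) (m≤n+m _ _)

sum-δ : (a : Fin n) (g : Fin n → ℕ) → sum (λ i → ⟦ does (a ≟ i) ⟧ * g i) ≡ g a
sum-δ {suc n} zero g = trans (cong₂ _+_ (+-identityʳ (g zero)) (trans (sum-const n 0) (*-zeroʳ n))) (+-identityʳ (g zero))
sum-δ {suc n} (suc a) g = sum-δ a (tail g)

∏-const : ∀ n (c : ℕ) → ∏ {n} (λ _ → c) ≡ c ^ n
∏-const zero    c = refl
∏-const (suc n) c = cong (c *_) (∏-const n c)

∏-^ : ∀ c (f : Fin n → ℕ) → ∏ (λ i → c ^ f i) ≡ c ^ sum f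
∏-^ {zero}  c f = refl
∏-^ {suc n} c f = trans (cong (c ^ f zero *_) (∏-^ c (tail f))) (sym (^-distribˡ-+-* c (f zero) _))

average : (f : Fin (suc n) → ℕ) → ∃ λ i → suc n * f i ≤ sum f
average {zero}  f = zero , ≤-refl
average {suc n} f with average (tail f)
... | i , avg with ≤-total (f zero) (f (suc i))
...   | inj₁ f₀≤ = zero , +-monoʳ-≤ (f zero) (≤-trans (*-monoʳ-≤ (suc n) f₀≤) avg)
...   | inj₂ f₀≥ = suc i , +-mono-≤ f₀≥ avg

∑ᶠ : ∀ m → ((Fin m → Fin n) → ℕ) → ℕ
∑ᶠ zero    F = F (λ ())
∑ᶠ (suc m) F = sum (λ x → ∑ᶠ m (λ f → F (x ◂ f)))

∑ᶠ-cong : ∀ m {F G : (Fin m → Fin n) → ℕ} → F ≗ G → ∑ᶠ m F ≡ ∑ᶠ m G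
∑ᶠ-cong zero    F≗G = F≗G _
∑ᶠ-cong (suc m) F≗G = sum-cong-≗ (λ x → ∑ᶠ-cong m (λ f → F≗G (x ◂ f)))

∑ᶠ-mono : ∀ m {F G : (Fin m → Fin n) → ℕ} → (∀ f → F f ≤ G f) → ∑ᶠ m F ≤ ∑ᶠ m G
∑ᶠ-mono zero    F≤G = F≤G _
∑ᶠ-mono (suc m) F≤G = sum-mono (λ x → ∑ᶠ-mono m (λ f → F≤G (x ◂ f)))

∑ᶠ-distrib-+ : ∀ m (F G : (Fin m → Fin n) → ℕ) → ∑ᶠ m (λ f → F f + G f) ≡ ∑ᶠ m F + ∑ᶠ m G
∑ᶠ-distrib-+ zero    F G = refl
∑ᶠ-distrib-+ {n} (suc m) F G = trans (sum-cong-≗ {n} (λ x → ∑ᶠ-distrib-+ m (λ f → F (x ◂ f)) (λ f → G (x ◂ f)))) (∑-distrib-+ {n} _ _)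

*-distribˡ-∑ᶠ : ∀ m c (F : (Fin m → Fin n) → ℕ) → c * ∑ᶠ m F ≡ ∑ᶠ m (λ f → c * F f)
*-distribˡ-∑ᶠ zero    c F = refl
*-distribˡ-∑ᶠ {n} (suc m) c F = trans (*-distribˡ-sum {n} c (λ x → ∑ᶠ m (λ f → F (x ◂ f)))) (sum-cong-≗ {n} (λ x → *-distribˡ-∑ᶠ m c (λ f → F (x ◂ f))))

∑ᶠ-const : ∀ m n (c : ℕ) → ∑ᶠ {n} m (λ _ → c) ≡ n ^ m * c
∑ᶠ-const zero    n c = sym (+-identityʳ c)
∑ᶠ-const (suc m) n c = trans (sum-cong-≗ {n} (λ _ → ∑ᶠ-const m n c)) (trans (sum-const n _) (sym (*-assoc n (n ^ m) c)))

∑ᶠ-sum-comm : ∀ m {k} (F : (Fin m → Fin n) → Fin k → ℕ) →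
              ∑ᶠ m (λ f → sum (F f)) ≡ sum (λ i → ∑ᶠ m (λ f → F f i))
∑ᶠ-sum-comm zero        F = refl
∑ᶠ-sum-comm {n} (suc m) {k} F = trans (sum-cong-≗ {n} (λ x → ∑ᶠ-sum-comm m (λ f → F (x ◂ f)))) (∑-comm {n} {k} _)

∑ᶠ-comm : ∀ m k {l} (F : (Fin m → Fin n) → (Fin k → Fin l) → ℕ) →
          ∑ᶠ m (λ f → ∑ᶠ k (F f)) ≡ ∑ᶠ k (λ g → ∑ᶠ m (λ f → F f g))
∑ᶠ-comm m zero        F = refl
∑ᶠ-comm m (suc k) {l} F = trans (∑ᶠ-sum-comm m (λ f x → ∑ᶠ k (λ g → F f (x ◂ g)))) (sum-cong-≗ {l} (λ x → ∑ᶠ-comm m k (λ f g → F f (x ◂ g))))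

-- Independence of the hash values: the sum over all functions of a product of coordinate terms
-- factors.
∑ᶠ-∏ : ∀ m (φ : Fin m → Fin n → ℕ) →
       ∑ᶠ m (λ f → ∏ (λ i → φ i (f i))) ≡ ∏ (λ i → sum (φ i))
∑ᶠ-∏ zero    φ = refl
∑ᶠ-∏ (suc m) φ = begin
  sum (λ x → ∑ᶠ m (λ f → φ zero x * ∏ (λ i → φ (suc i) (f i)))) ≡⟨ sum-cong-≗ (λ x → *-distribˡ-∑ᶠ m (φ zero x) _) ⟨
  sum (λ x → φ zero x * ∑ᶠ m (λ f → ∏ (λ i → φ (suc i) (f i)))) ≡⟨ sum-cong-≗ (λ x → cong (φ zero x *_) (∑ᶠ-∏ m (tail φ))) ⟩
  sum (λ x → φ zero x * P)                                      ≡⟨ sum-cong-≗ (λ x → *-comm (φ zero x) P) ⟩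
  sum (λ x → P * φ zero x)                                      ≡⟨ *-distribˡ-sum P (φ zero) ⟨
  P * sum (φ zero)                                              ≡⟨ *-comm P _ ⟩
  sum (φ zero) * P                                              ∎
  where
  open ≡-Reasoning
  P = ∏ (λ i → sum (φ (suc i)))

-- `f` is only pointwise equal to the function `f zero ◂ tail f` that the sum runs through, so `F`
-- has to respect pointwise equality.
term≤∑ᶠ : ∀ m {F : (Fin m → Fin n) → ℕ} → (∀ {f g} → f ≗ g → F f ≡ F g) → ∀ f → F f ≤ ∑ᶠ m F
term≤∑ᶠ zero    ext f = ≤-reflexive (ext (λ ()))
term≤∑ᶠ (suc m) {F} ext f = begin
  F f                                  ≡⟨ ext (λ { zero → refl ; (suc i) → refl }) ⟩
  F (f zero ◂ tail f)                  ≤⟨ term≤∑ᶠ m (λ eq → ext (λ { zero → refl ; (suc i) → eq i })) (tail f) ⟩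
  ∑ᶠ m (λ g → F (f zero ◂ g))          ≤⟨ term≤sum (λ x → ∑ᶠ m (λ g → F (x ◂ g))) (f zero) ⟩
  ∑ᶠ (suc m) F                         ∎
  where open ≤-Reasoning

averageᶠ : ∀ m {n} → 0 < n → (F : (Fin m → Fin n) → ℕ) → ∃ λ f → n ^ m * F f ≤ ∑ᶠ m F
averageᶠ zero    _   F = (λ ()) , ≤-reflexive (+-identityʳ _)
averageᶠ (suc m) {n@(suc _)} 0<n F with average (λ x → ∑ᶠ m (λ f → F (x ◂ f)))
... | x , x-avg with averageᶠ m 0<n (λ f → F (x ◂ f))
...   | f , f-avg = (x ◂ f) , (begin
  n ^ suc m * F (x ◂ f)              ≡⟨ *-assoc n (n ^ m) _ ⟩
  n * (n ^ m * F (x ◂ f))            ≤⟨ *-monoʳ-≤ n f-avg ⟩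
  n * ∑ᶠ m (λ g → F (x ◂ g))         ≤⟨ x-avg ⟩
  ∑ᶠ (suc m) F                       ∎)
  where open ≤-Reasoning

-- One round of matching

Subset : ℕ → Set
Subset m = Fin m → Bool

-- Nothing is required at `u`, so the sets may also be equal there. This "at most one difference" is
-- the invariant carried through the rounds.
AgreeOff : Fin m → Subset m → Subset m → Set
AgreeOff u p q = ∀ v → v ≢ u → p v ≡ q v

first : Subset m → Maybe (Fin m)
first {zero}  p = nothing
first {suc m} p = if p zero then just zero else Maybe.map suc (first (tail p))

first-cong : {p q : Subset m} → p ≗ q → first p ≡ first q
first-cong {zero}  p≗q = refl
first-cong {suc m} p≗q rewrite p≗q zero | first-cong (λ v → p≗q (suc v)) = refl

first-just : (p : Subset m) {v : Fin m} → first p ≡ just v → p v ≡ true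
first-just {suc m} p eq with p zero in p₀
first-just {suc m} p refl | true = p₀
... | false with first (tail p) in eq′
first-just {suc m} p refl | false | just v = first-just (tail p) eq′

first-nonempty : (p : Subset m) {v : Fin m} → p v ≡ true → ∃ λ u → first p ≡ just u
first-nonempty p {zero} pv rewrite pv = zero , refl
first-nonempty p {suc v} pv with p zero
... | true  = zero , refl
... | false with first-nonempty (tail p) pv
...   | u , eq rewrite eq = suc u , refl

first-insert : {p q : Subset m} {u : Fin m} → AgreeOff u p q → q u ≡ true →
               first q ≡ just u ⊎ first q ≡ first p
first-insert {u = zero} agree qu rewrite qu = inj₁ refl
first-insert {p = p} {q} {suc u} agree qu rewrite agree zero (λ ()) with q zero
... | true  = inj₂ refl
... | false with first-insert {p = tail p} {tail q} (λ v v≢u → agree (suc v) (v≢u ∘ suc-injective)) qu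
...   | inj₁ eq rewrite eq = inj₁ refl
...   | inj₂ eq rewrite eq = inj₂ refl

-- The arguments are an element, the leader of its own side in its bin, and the leader of the
-- opposite side: only a leader receives a partner.
link : Fin m → Maybe (Fin m) → Maybe (Fin m) → Maybe (Fin m)
link v (just x) y = if does (x ≟ v) then y else nothing
link v nothing  y = nothing

link-refl : ∀ (v : Fin m) y → link v (just v) y ≡ y
link-refl v y rewrite dec-true (v ≟ v) refl = refl

link-≢ : {v : Fin m} {l : Maybe (Fin m)} → ∀ y → l ≢ just v → link v l y ≡ nothing
link-≢ {v = v} {just x} y l≢v rewrite dec-false (x ≟ v) (l≢v ∘ cong just) = refl
link-≢ {l = nothing} y l≢v = refl

link-nothing : ∀ (v : Fin m) l → link v l nothing ≡ nothing
link-nothing v nothing = refl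
link-nothing v (just x) with does (x ≟ v)
... | true  = refl
... | false = refl

link-just : {v u : Fin m} → ∀ l y → link v l y ≡ just u → l ≡ just v × y ≡ just u
link-just {v = v} (just x) y eq with x ≟ v
... | yes refl = refl , eq

module Matching {M : ℕ} (side : Fin M → Bool) where

  bin : (Fin M → Fin n) → Subset M → Bool → Fin n → Subset M
  bin h X s b v = X v ∧ does (side v ≟ᵇ s) ∧ does (h v ≟ b)

  leader : (Fin M → Fin n) → Subset M → Bool → Fin n → Maybe (Fin M)
  leader h X s b = first (bin h X s b)

  partner : (Fin M → Fin n) → Subset M → Fin M → Maybe (Fin M)
  partner h X v = link v (leader h X (side v) (h v)) (leader h X (not (side v)) (h v))

  rem : (Fin M → Fin n) → Subset M → Subset M
  rem h X v = X v ∧ is-nothing (partner h X v)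

  -- The number of bins is packed with the hash function so that phases with different numbers of
  -- bins can be concatenated.
  Round : Set
  Round = ∃ λ n → Fin M → Fin n

  run : List Round → Subset M → Subset M
  run []             X = X
  run ((_ , h) ∷ hs) X = run hs (rem h X)

  match : List Round → Subset M → Fin M → Maybe (Fin M)
  match []             X v = nothing
  match ((_ , h) ∷ hs) X v = partner h X v <∣> match hs (rem h X) v

  module _ (h : Fin M → Fin n) where

    bin-true : ∀ X {s b v} → bin h X s b v ≡ true → X v ≡ true × side v ≡ s × h v ≡ b
    bin-true X {s} {b} {v} eq with X v | side v ≟ᵇ s | h v ≟ b
    ... | true | yes p | yes q = refl , p , q

    bin-self : ∀ X {v} → X v ≡ true → bin h X (side v) (h v) v ≡ true
    bin-self X {v} Xv rewrite Xv | dec-true (side v ≟ᵇ side v) refl | dec-true (h v ≟ h v) refl = refl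

    bin-cong : ∀ {X Y s b v} → X v ≡ Y v → bin h X s b v ≡ bin h Y s b v
    bin-cong {s = s} {b} {v} = cong (_∧ does (side v ≟ᵇ s) ∧ does (h v ≟ b))

    bin-outside : ∀ {X Y s b v} → ¬ (side v ≡ s × h v ≡ b) → bin h X s b v ≡ bin h Y s b v
    bin-outside {X} {Y} {s} {b} {v} ¬eq with side v ≟ᵇ s | h v ≟ b
    ... | yes p | yes q = contradiction (p , q) ¬eq
    ... | yes p | no  _ = trans (∧-zeroʳ (X v)) (sym (∧-zeroʳ (Y v)))
    ... | no  _ | _     = trans (∧-zeroʳ (X v)) (sym (∧-zeroʳ (Y v)))

    leader-just : ∀ X {s b v} → leader h X s b ≡ just v → X v ≡ true × side v ≡ s × h v ≡ b
    leader-just X {s} {b} eq = bin-true X (first-just (bin h X s b) eq)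

    leader-nonempty : ∀ X {v} → X v ≡ true → ∃ λ u → leader h X (side v) (h v) ≡ just u
    leader-nonempty X {v} Xv = first-nonempty (bin h X (side v) (h v)) {v} (bin-self X Xv)

    partner-sym : ∀ X {v y} → partner h X v ≡ just y → partner h X y ≡ just v
    partner-sym X {v} {y} eq with link-just (leader h X (side v) (h v)) _ eq
    ... | lv , ly with leader-just X ly
    ...   | _ , sy , hy rewrite sy | hy | not-involutive (side v) | lv | ly = link-refl y (just v)

    partner-just : ∀ X {v y} → partner h X v ≡ just y → X v ≡ true × side y ≡ not (side v)
    partner-just X {v} eq with link-just (leader h X (side v) (h v)) _ eq
    ... | lv , ly = proj₁ (leader-just X lv) , proj₁ (proj₂ (leader-just X ly))

    rem-just : ∀ X {v y} → partner h X v ≡ just y → rem h X v ≡ false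
    rem-just X {v} eq rewrite eq = ∧-zeroʳ (X v)

    rem-false : ∀ X {v} → X v ≡ false → rem h X v ≡ false
    rem-false X Xv rewrite Xv = refl

    rem-cong-at : ∀ X Y {v} → X v ≡ Y v → partner h X v ≡ partner h Y v → rem h X v ≡ rem h Y v
    rem-cong-at X Y eq eq′ = cong₂ (λ x y → x ∧ is-nothing y) eq eq′

    leader-cong : ∀ {X Y} → X ≗ Y → ∀ s b → leader h X s b ≡ leader h Y s b
    leader-cong {X} {Y} X≗Y s b = first-cong (λ v → bin-cong {X} {Y} (X≗Y v))

    partner-cong-at : ∀ X Y {v} → leader h X (side v) (h v) ≡ leader h Y (side v) (h v) →
                      leader h X (not (side v)) (h v) ≡ leader h Y (not (side v)) (h v) →
                      partner h X v ≡ partner h Y v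
    partner-cong-at X Y {v} = cong₂ (link v)

    partner-cong : ∀ {X Y} → X ≗ Y → partner h X ≗ partner h Y
    partner-cong {X} {Y} X≗Y v = partner-cong-at X Y (leader-cong X≗Y _ _) (leader-cong X≗Y _ _)

    rem-cong : ∀ {X Y} → X ≗ Y → rem h X ≗ rem h Y
    rem-cong {X} {Y} X≗Y v = rem-cong-at X Y (X≗Y v) (partner-cong X≗Y v)

    -- Only `p` is handed on as a difference to the next round, and besides it only `u` and `c` may
    -- change partners. This is the source of the 3 changes per round.
    Stable : Subset M → Subset M → Fin M → Set
    Stable X Y u = ∃₂ λ p c → AgreeOff p (rem h X) (rem h Y) ×
                   (∀ v → v ≢ u → v ≢ c → v ≢ p → partner h X v ≡ partner h Y v)

    -- The inserted element can only displace the leader of its own bin and side; that leader,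
    -- or else the mate that u finds there, is the one element that changes among the rest.
    module Insert {X Y : Subset M} {u : Fin M} (agree : AgreeOff u X Y)
                  (Xu : X u ≡ false) (Yu : Y u ≡ true) where

      leader-off : ∀ s b → ¬ (side u ≡ s × h u ≡ b) → leader h X s b ≡ leader h Y s b
      leader-off s b ¬eq = first-cong λ v → agree-at v
        where
        agree-at : ∀ v → bin h X s b v ≡ bin h Y s b v
        agree-at v with v ≟ u
        ... | yes refl = bin-outside {X} {Y} ¬eq
        ... | no v≢u   = bin-cong {X} {Y} (agree v v≢u)

      old  = leader h X (side u) (h u)
      mate = leader h X (not (side u)) (h u)

      mate-Y : leader h Y (not (side u)) (h u) ≡ mate
      mate-Y = sym (leader-off _ _ (λ eq → not-¬ refl (proj₁ eq)))

      leader-at : leader h Y (side u) (h u) ≡ just u ⊎ leader h Y (side u) (h u) ≡ old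
      leader-at = first-insert (λ v v≢u → bin-cong {X} {Y} (agree v v≢u)) (bin-self Y Yu)

      module _ (new : leader h Y (side u) (h u) ≡ just u) where

        -- The disjunction covers the displaced leader: it may change partner only if there was a
        -- mate to lose.
        partner-off : ∀ v → v ≢ u → mate ≢ just v → old ≢ just v ⊎ mate ≡ nothing →
                      partner h X v ≡ partner h Y v
        partner-off v v≢u mate≢v old≢v with h v ≟ h u
        ... | no hv≢hu = partner-cong-at X Y (leader-off _ _ (hv≢hu ∘ sym ∘ proj₂)) (leader-off _ _ (hv≢hu ∘ sym ∘ proj₂))
        ... | yes hv≡hu with side v ≟ᵇ side u
        ...   | yes sv≡su rewrite hv≡hu | sv≡su | new =
          trans (idle old≢v) (sym (link-≢ _ (v≢u ∘ sym ∘ just-injective)))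
          where
          idle : old ≢ just v ⊎ mate ≡ nothing → link v old mate ≡ nothing
          idle (inj₁ old≢v) = link-≢ mate old≢v
          idle (inj₂ eq) rewrite eq = link-nothing v old
        ...   | no sv≢su rewrite hv≡hu | ¬-not sv≢su =
          trans (link-≢ _ mate≢v) (sym (link-≢ _ (λ eq → mate≢v (trans (sym mate-Y) eq))))

        partner-new : ∀ {y} → mate ≡ just y → partner h Y u ≡ just y
        partner-new eq rewrite new | mate-Y | eq = link-refl u _

        rem-u : ∀ {y} → mate ≡ just y → rem h X u ≡ rem h Y u
        rem-u eq = trans (rem-false X Xu) (sym (rem-just Y (partner-new eq)))

        stable : Stable X Y u
        stable with mate in m-eq | old in o-eq
        -- Without a mate nothing is matched in this bin before or after, and `u` itself remains the
        -- difference.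
        ... | nothing | _ = u , u , (λ v v≢u → rem-cong-at X Y (agree v v≢u) (idle v v≢u)) , λ v v≢u _ _ → idle v v≢u
          where
          idle : ∀ v → v ≢ u → partner h X v ≡ partner h Y v
          idle v v≢u = partner-off v v≢u (λ eq → contradiction (trans (sym m-eq) eq) λ ()) (inj₂ m-eq)
        -- The mate was idle and is now taken by `u`; the second witness is only a filler.
        ... | just y | nothing = y , u , rem-off , λ v v≢u _ v≢y → off v v≢u v≢y
          where
          off : ∀ v → v ≢ u → v ≢ y → partner h X v ≡ partner h Y v
          off v v≢u v≢y = partner-off v v≢u (λ eq → v≢y (sym (just-injective (trans (sym m-eq) eq))))
                                            (inj₁ (λ eq → contradiction (trans (sym o-eq) eq) λ ()))
          rem-off : AgreeOff y (rem h X) (rem h Y)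
          rem-off v v≢y with v ≟ u
          ... | yes refl = rem-u m-eq
          ... | no v≢u   = rem-cong-at X Y (agree v v≢u) (off v v≢u v≢y)
        -- The mate moves from `x` to `u` and leaves in both runs, while `x` is now left over.
        ... | just y | just x = x , y , rem-off , off
          where
          off : ∀ v → v ≢ u → v ≢ y → v ≢ x → partner h X v ≡ partner h Y v
          off v v≢u v≢y v≢x = partner-off v v≢u (λ eq → v≢y (sym (just-injective (trans (sym m-eq) eq))))
                                                (inj₁ (λ eq → v≢x (sym (just-injective (trans (sym o-eq) eq)))))
          partner-x : partner h X x ≡ just y
          partner-x with leader-just X o-eq
          ... | _ , sx , hx rewrite sx | hx | o-eq | m-eq = link-refl x (just y)
          rem-off : AgreeOff x (rem h X) (rem h Y)
          rem-off v v≢x with v ≟ u | v ≟ y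
          ... | yes refl | _        = rem-u m-eq
          ... | no v≢u   | yes refl = trans (rem-just X (partner-sym X partner-x))
                                            (sym (rem-just Y (partner-sym Y (partner-new m-eq))))
          ... | no v≢u   | no v≢y   = rem-cong-at X Y (agree v v≢u) (off v v≢u v≢y v≢x)

      insert-stable : Stable X Y u
      insert-stable with leader-at
      ... | inj₁ new  = stable new
      ... | inj₂ same = u , u , (λ v v≢u → rem-cong-at X Y (agree v v≢u) (partner-eq v)) , λ v _ _ _ → partner-eq v
        where
        leader-eq : ∀ s b → leader h X s b ≡ leader h Y s b
        leader-eq s b with side u ≟ᵇ s | h u ≟ b
        ... | yes refl | yes refl = sym same
        ... | yes _    | no hu≢b  = leader-off s b (hu≢b ∘ proj₂)
        ... | no su≢s  | _        = leader-off s b (su≢s ∘ proj₁)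
        partner-eq : ∀ v → partner h X v ≡ partner h Y v
        partner-eq v = partner-cong-at X Y (leader-eq _ _) (leader-eq _ _)

    change-stable : ∀ {X Y u} → AgreeOff u X Y → Stable X Y u
    change-stable {X} {Y} {u} agree with X u ≟ᵇ Y u
    ... | yes Xu≡Yu = u , u , (λ v _ → rem-cong X≗Y v) , λ v _ _ _ → partner-cong X≗Y v
      where
      X≗Y : X ≗ Y
      X≗Y v with v ≟ u
      ... | yes refl = Xu≡Yu
      ... | no v≢u   = agree v v≢u
    ... | no Xu≢Yu with X u in Xu | Y u in Yu
    ...   | false | false = contradiction refl Xu≢Yu
    ...   | true  | true  = contradiction refl Xu≢Yu
    ...   | false | true  = Insert.insert-stable agree Xu Yu
    -- A deletion is an insertion read backwards.
    ...   | true  | false with Insert.insert-stable (λ v v≢u → sym (agree v v≢u)) Yu Xu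
    ...     | p , c , agree′ , same = p , c , (λ v v≢p → sym (agree′ v v≢p)) , λ v v≢u v≢c v≢p → sym (same v v≢u v≢c v≢p)

  run-cong : ∀ hs {X Y} → X ≗ Y → run hs X ≗ run hs Y
  run-cong []             X≗Y = X≗Y
  run-cong ((_ , h) ∷ hs) X≗Y = run-cong hs (rem-cong h X≗Y)

  -- The element `p` of one round serves as `u` of the next. The list of exceptions may contain
  -- repetitions, so its length is exact.
  match-stable : ∀ hs {X Y u} → AgreeOff u X Y →
                 ∃ λ es → length es ≡ 3 * length hs × (∀ v → v ∉ es → match hs X v ≡ match hs Y v)
  match-stable []             agree = [] , refl , λ _ _ → refl
  match-stable ((_ , h) ∷ hs) {u = u} agree with change-stable h agree
  ... | p , c , agree′ , same with match-stable hs agree′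
  ...   | es , len , same′ = u ∷ c ∷ p ∷ es
                           , trans (cong (3 +_) len) (sym (*-suc 3 (length hs)))
                           , λ v v∉ → cong₂ _<∣>_ (same v (v∉ ∘ here) (v∉ ∘ there ∘ here) (v∉ ∘ there ∘ there ∘ here))
                                                  (same′ v (v∉ ∘ there ∘ there ∘ there))

  match-sym : ∀ hs X {v y} → match hs X v ≡ just y →
              match hs X y ≡ just v × X v ≡ true × side y ≡ not (side v)
  match-sym ((_ , h) ∷ hs) X {v} {y} eq with partner h X v in eq-v
  match-sym ((_ , h) ∷ hs) X {v} {y} refl | just _ with partner-just h X eq-v
  ... | Xv , sy rewrite partner-sym h X eq-v = refl , Xv , sy
  match-sym ((_ , h) ∷ hs) X {v} {y} eq | nothing with match-sym hs (rem h X) eq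
  ... | eq-y , rem-v , sy with match-sym hs (rem h X) eq-y
  -- Since `y` is still present after this round, it had no partner in it, and its match is the
  -- later one.
  ...   | _ , rem-y , _ with X v | X y | partner h X y
  ...     | true | true | nothing = eq-y , refl , sy

  match-total : ∀ hs X {v} → X v ≡ true → run hs X v ≡ false → ∃ λ y → match hs X v ≡ just y
  match-total [] X Xv Xv′ = contradiction (trans (sym Xv) Xv′) λ ()
  match-total ((_ , h) ∷ hs) X {v} Xv gone with partner h X v in eq
  ... | just y  = y , refl
  ... | nothing = match-total hs (rem h X) (cong₂ (λ x y → x ∧ is-nothing y) Xv eq) gone

-- The average number of elements left by a round

⟦∧⟧ : ∀ p q → ⟦ p ∧ q ⟧ ≡ ⟦ p ⟧ * ⟦ q ⟧
⟦∧⟧ true  q = sym (+-identityʳ ⟦ q ⟧)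
⟦∧⟧ false q = refl

sum-pick : ∀ {n} (a : Fin n) (p : Fin n → Bool) → sum (λ i → ⟦ does (a ≟ i) ∧ p i ⟧) ≡ ⟦ p a ⟧
sum-pick {n} a p = trans (sum-cong-≗ {n} (λ i → ⟦∧⟧ (does (a ≟ i)) (p i))) (sum-δ a (⟦_⟧ ∘ p))

hit : Maybe (Fin n) → Fin n → Bool
hit (just x) v = does (x ≟ v)
hit nothing  v = false

hit-true : ∀ l {v : Fin n} → hit l v ≡ true → l ≡ just v
hit-true (just x) {v} eq with x ≟ v
... | yes refl = refl

hit-link : ∀ (v : Fin n) l y → hit l v ∧ (is-just l ∧ is-just y) ≡ is-just (link v l y)
hit-link v nothing y = refl
hit-link v (just x) y with does (x ≟ v)
... | true  = refl
... | false = refl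


-- Labels of a bin: 0 admits elements of both sides, 1 only those of side `true`,
-- 2 only those of side `false`.
admits : Fin 3 → Bool → Bool
admits zero             s = true
admits (suc zero)       s = s
admits (suc (suc zero)) s = not s

isBoth : Fin 3 → Bool
isBoth zero    = true
isBoth (suc _) = false

-- Instead of dividing by 16 for every bin labelled both, every other bin is charged 16, which
-- normalises the total to 16^n.
cost : Fin 3 → ℕ
cost zero    = 1
cost (suc _) = 16

label : Bool → Bool → Fin 3
label true  true  = zero
label true  false = suc zero
-- This clause also covers empty bins, where any label would be respected.
label false _     = suc (suc zero)

#both : (Fin n → Fin 3) → ℕ
#both σ = sum (⟦_⟧ ∘ isBoth ∘ σ)

#admits : (Fin n → Fin 3) → Bool → ℕ
#admits σ s = sum (λ b → ⟦ admits (σ b) s ⟧)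

#admits-sum : ∀ {n} (σ : Fin n → Fin 3) → #admits σ true + #admits σ false ≡ n + #both σ
#admits-sum {n} σ = begin
  #admits σ true + #admits σ false                              ≡⟨ ∑-distrib-+ {n} _ _ ⟨
  sum (λ b → ⟦ admits (σ b) true ⟧ + ⟦ admits (σ b) false ⟧)    ≡⟨ sum-cong-≗ {n} (λ b → pointwise (σ b)) ⟩
  sum (λ b → 1 + ⟦ isBoth (σ b) ⟧)                              ≡⟨ ∑-distrib-+ {n} (λ _ → 1) _ ⟩
  sum {n} (λ _ → 1) + #both σ                                   ≡⟨ cong (_+ #both σ) (trans (sum-const n 1) (*-identityʳ n)) ⟩
  n + #both σ                                                   ∎
  where
  open ≡-Reasoning
  pointwise : ∀ l → ⟦ admits l true ⟧ + ⟦ admits l false ⟧ ≡ 1 + ⟦ isBoth l ⟧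
  pointwise zero             = refl
  pointwise (suc zero)       = refl
  pointwise (suc (suc zero)) = refl

⟦⟧≤1 : ∀ p → ⟦ p ⟧ ≤ 1
⟦⟧≤1 true  = ≤-refl
⟦⟧≤1 false = z≤n

sum-indicator≤ : ∀ {n} (p : Fin n → Bool) → sum (⟦_⟧ ∘ p) ≤ n
sum-indicator≤ {n} p = ≤-trans (sum-mono (⟦⟧≤1 ∘ p)) (≤-reflexive (trans (sum-const n 1) (*-identityʳ n)))

∏cost : (Fin n → Fin 3) → ℕ
∏cost σ = ∏ (cost ∘ σ)

∏cost-#both : ∀ {n} (σ : Fin n → Fin 3) → ∏cost σ * 16 ^ #both σ ≡ 16 ^ n
∏cost-#both {n} σ = begin
  ∏cost σ * 16 ^ #both σ                             ≡⟨ cong (∏cost σ *_) (∏-^ 16 (⟦_⟧ ∘ isBoth ∘ σ)) ⟨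
  ∏cost σ * ∏ (λ b → 16 ^ ⟦ isBoth (σ b) ⟧)          ≡⟨ ∏-distrib-* {n} _ _ ⟨
  ∏ (λ b → cost (σ b) * 16 ^ ⟦ isBoth (σ b) ⟧)       ≡⟨ ∏-cong {n} (λ b → pointwise (σ b)) ⟩
  ∏ {n} (λ _ → 16)                                   ≡⟨ ∏-const n 16 ⟩
  16 ^ n                                             ∎
  where
  open ≡-Reasoning
  pointwise : ∀ l → cost l * 16 ^ ⟦ isBoth l ⟧ ≡ 16
  pointwise zero    = refl
  pointwise (suc _) = refl

size : Subset n → ℕ
size X = sum (⟦_⟧ ∘ X)

module Counting {M : ℕ} (side : Fin M → Bool) where

  open Matching side

  count : Bool → Subset M → ℕ
  count s X = sum (λ v → ⟦ X v ∧ does (side v ≟ᵇ s) ⟧)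

  size≡count+count : ∀ X → size X ≡ count true X + count false X
  size≡count+count X = trans (sum-cong-≗ {M} (λ v → pointwise (X v) (side v))) (∑-distrib-+ {M} _ _)
    where
    pointwise : ∀ x s → ⟦ x ⟧ ≡ ⟦ x ∧ does (s ≟ᵇ true) ⟧ + ⟦ x ∧ does (s ≟ᵇ false) ⟧
    pointwise false _     = refl
    pointwise true  true  = refl
    pointwise true  false = refl

  count-cong : ∀ {X Y} → X ≗ Y → ∀ s → count s X ≡ count s Y
  count-cong X≗Y s = sum-cong-≗ {M} (λ v → cong (λ x → ⟦ x ∧ does (side v ≟ᵇ s) ⟧) (X≗Y v))

  module _ (h : Fin M → Fin n) (X : Subset M) where

    matched : Fin n → Bool
    matched b = is-just (leader h X true b) ∧ is-just (leader h X false b)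

    #matched : ℕ
    #matched = sum (⟦_⟧ ∘ matched)

    matched-sides : ∀ s b → matched b ≡ is-just (leader h X s b) ∧ is-just (leader h X (not s) b)
    matched-sides true  b = refl
    matched-sides false b = ∧-comm (is-just (leader h X true b)) _

    hit-leader : ∀ s b v → hit (leader h X s b) v ∧ matched b ≡
                 does (h v ≟ b) ∧ (does (side v ≟ᵇ s) ∧ is-just (partner h X v))
    hit-leader s b v with h v ≟ b | side v ≟ᵇ s
    ... | yes refl | yes refl = trans (cong (hit (leader h X s b) v ∧_) (matched-sides s b))
                                      (hit-link v (leader h X s b) (leader h X (not s) b))
    ... | yes _ | no sv≢s with hit (leader h X s b) v in eq
    ...   | true  = contradiction (proj₁ (proj₂ (leader-just h X (hit-true _ eq)))) sv≢s
    ...   | false = refl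
    hit-leader s b v | no hv≢b | _ with hit (leader h X s b) v in eq
    ...   | true  = contradiction (proj₂ (proj₂ (leader-just h X (hit-true _ eq)))) hv≢b
    ...   | false = refl

    sum-hit : ∀ l c → (c ≡ true → ∃ λ x → l ≡ just x) → sum {M} (λ v → ⟦ hit l v ∧ c ⟧) ≡ ⟦ c ⟧
    sum-hit (just x) c     _  = sum-pick x (λ _ → c)
    sum-hit nothing  true  ex with ex refl
    ... | _ , ()
    sum-hit nothing  false _  = trans (sum-const M 0) (*-zeroʳ M)

    leader-matched : ∀ s b → matched b ≡ true → ∃ λ x → leader h X s b ≡ just x
    leader-matched s b eq with leader h X s b | trans (sym (matched-sides s b)) eq
    ... | just x | _ = x , refl

    -- Double counting of pairs of a bin and its matched leader: per element only its own bin can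
    -- contribute, per matched bin exactly one leader. The loss is the same on both sides, which
    -- preserves balance.
    count-rem : ∀ s → count s X ≡ count s (rem h X) + #matched
    count-rem s = begin
      count s X                                                        ≡⟨ sum-cong-≗ {M} split ⟩
      sum (λ v → ⟦ rem h X v ∧ σ v ⟧ + sum (λ b → ⟦ hit (leader h X s b) v ∧ matched b ⟧)) ≡⟨ ∑-distrib-+ {M} _ _ ⟩
      count s (rem h X) + sum (λ v → sum (λ b → ⟦ hit (leader h X s b) v ∧ matched b ⟧))   ≡⟨ cong (count s (rem h X) +_) (∑-comm {M} {n} _) ⟩
      count s (rem h X) + sum (λ b → sum (λ v → ⟦ hit (leader h X s b) v ∧ matched b ⟧))   ≡⟨ cong (count s (rem h X) +_) (sum-cong-≗ {n} (λ b → sum-hit _ _ (leader-matched s b))) ⟩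
      count s (rem h X) + #matched                                     ∎
      where
      open ≡-Reasoning
      σ : Fin M → Bool
      σ v = does (side v ≟ᵇ s)
      cases : ∀ x y (c : Bool) → (y ≡ true → x ≡ true) → ⟦ x ∧ c ⟧ ≡ ⟦ (x ∧ not y) ∧ c ⟧ + ⟦ c ∧ y ⟧
      cases true  true  true  _ = refl
      cases true  true  false _ = refl
      cases true  false true  _ = refl
      cases true  false false _ = refl
      cases false true  c     f with () ← f refl
      cases false false true  _ = refl
      cases false false false _ = refl
      partner⇒X : ∀ v → is-just (partner h X v) ≡ true → X v ≡ true
      partner⇒X v eq with partner h X v in p-eq
      ... | just y = proj₁ (partner-just h X p-eq)
      split : ∀ v → ⟦ X v ∧ σ v ⟧ ≡ ⟦ rem h X v ∧ σ v ⟧ + sum (λ b → ⟦ hit (leader h X s b) v ∧ matched b ⟧)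
      split v = trans (cases (X v) (is-just (partner h X v)) (σ v) (partner⇒X v))
                      (cong (⟦ rem h X v ∧ σ v ⟧ +_) (sym (trans (sum-cong-≗ {n} (λ b → cong ⟦_⟧ (hit-leader s b v)))
                                                                   (sum-pick (h v) (λ _ → σ v ∧ is-just (partner h X v))))))

    size-rem : size X ≡ size (rem h X) + (#matched + #matched)
    size-rem = begin
      size X                                       ≡⟨ size≡count+count X ⟩
      count true X + count false X                 ≡⟨ cong₂ _+_ (count-rem true) (count-rem false) ⟩
      (count true R + #matched) + (count false R + #matched) ≡⟨ rearrange (count true R) (count false R) #matched ⟩
      (count true R + count false R) + (#matched + #matched) ≡⟨ cong (_+ (#matched + #matched)) (size≡count+count R) ⟨
      size R + (#matched + #matched)               ∎
      where
      open ≡-Reasoning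
      R = rem h X
      rearrange : ∀ a b k → (a + k) + (b + k) ≡ (a + b) + (k + k)
      rearrange = solve-∀

  module _ (X : Subset M) where

    -- Elements outside `X` are compatible with every bin, so they contribute the full factor n and
    -- leave probabilities unaffected.
    compatible : (Fin n → Fin 3) → Fin M → Fin n → ℕ
    compatible σ v b = ⟦ not (X v) ∨ admits (σ b) (side v) ⟧

    weight : (Fin M → Fin n) → (Fin n → Fin 3) → ℕ
    weight h σ = ∏cost σ * ∏ (λ v → compatible σ v (h v))

    -- The term of the labelling in which matched bins admit both sides, and every other bin
    -- only the side that occurs in it, already dominates.
    rem≤∑weight : (h : Fin M → Fin n) → 4 ^ size (rem h X) * 16 ^ n ≤ 4 ^ size X * ∑ᶠ n (weight h)
    rem≤∑weight {n} h = begin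
      4 ^ size R * 16 ^ n                        ≡⟨ cong (4 ^ size R *_) (trans (cong (λ e → ∏cost σ * 16 ^ e) #both-σ) (∏cost-#both σ)) ⟨
      4 ^ size R * (∏cost σ * 16 ^ k)            ≡⟨ cong (λ e → 4 ^ size R * (∏cost σ * e)) (trans (^-distribʳ-* 4 4 k) (sym (^-distribˡ-+-* 4 k k))) ⟩
      4 ^ size R * (∏cost σ * 4 ^ (k + k))       ≡⟨ rearrange (4 ^ size R) (∏cost σ) (4 ^ (k + k)) ⟩
      4 ^ size R * 4 ^ (k + k) * ∏cost σ         ≡⟨ cong (_* ∏cost σ) (^-distribˡ-+-* 4 (size R) (k + k)) ⟨
      4 ^ (size R + (k + k)) * ∏cost σ           ≡⟨ cong (λ e → 4 ^ e * ∏cost σ) (size-rem h X) ⟨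
      4 ^ size X * ∏cost σ                       ≡⟨ cong (4 ^ size X *_) weight-σ ⟨
      4 ^ size X * weight h σ                    ≤⟨ *-monoʳ-≤ (4 ^ size X) (term≤∑ᶠ n weight-ext σ) ⟩
      4 ^ size X * ∑ᶠ n (weight h)               ∎
      where
      open ≤-Reasoning
      R = rem h X
      k = #matched h X
      σ : Fin n → Fin 3
      σ b = label (is-just (leader h X true b)) (is-just (leader h X false b))
      rearrange : ∀ x y z → x * (y * z) ≡ x * z * y
      rearrange = solve-∀
      isBoth-label : ∀ p q → p ∧ q ≡ isBoth (label p q)
      isBoth-label true  true  = refl
      isBoth-label true  false = refl
      isBoth-label false _     = refl
      #both-σ : k ≡ #both σ
      #both-σ = sum-cong-≗ {n} (λ b → cong ⟦_⟧ (isBoth-label (is-just (leader h X true b)) _))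
      admits-label : ∀ s p q → (if s then p else q) ≡ true → admits (label p q) s ≡ true
      admits-label true  true  true  _ = refl
      admits-label true  true  false _ = refl
      admits-label false true  true  _ = refl
      admits-label false false true  _ = refl
      nonempty : ∀ {v} → X v ≡ true → ∀ s → side v ≡ s →
                 (if s then is-just (leader h X true (h v)) else is-just (leader h X false (h v))) ≡ true
      nonempty Xv true  sv with leader-nonempty h X Xv
      ... | _ , eq rewrite sv | eq = refl
      nonempty Xv false sv with leader-nonempty h X Xv
      ... | _ , eq rewrite sv | eq = refl
      compatible-σ : ∀ v → compatible σ v (h v) ≡ 1
      compatible-σ v with X v in Xv
      ... | false = refl
      ... | true  = cong ⟦_⟧ (admits-label (side v) _ _ (nonempty Xv (side v) refl))
      weight-σ : weight h σ ≡ ∏cost σ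
      weight-σ = trans (cong (∏cost σ *_) (trans (∏-cong {M} compatible-σ) (trans (∏-const M 1) (^-zeroˡ M)))) (*-identityʳ _)
      weight-ext : ∀ {f g} → f ≗ g → weight h f ≡ weight h g
      weight-ext f≗g = cong₂ _*_ (∏-cong {n} (λ b → cong cost (f≗g b)))
                                 (∏-cong {M} (λ v → cong (λ l → ⟦ not (X v) ∨ admits l (side v) ⟧) (f≗g (h v))))

    -- The left product counts the hash functions that respect σ, as hash values are independent.
    -- Clearing denominators gives the form assumed by `compatible-bound`.
    ∏-sum-compatible : ∀ {n} (σ : Fin n → Fin 3) →
      ∏ (λ v → sum (compatible σ v)) * (n ^ count true X * n ^ count false X) ≡
      n ^ M * (#admits σ true ^ count true X * #admits σ false ^ count false X)
    ∏-sum-compatible {n} σ = begin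
      ∏ c * (n ^ count true X * n ^ count false X)                 ≡⟨ cong (∏ c *_) (as-∏ (λ _ → n)) ⟩
      ∏ c * ∏ (λ v → n ^ e true v * n ^ e false v)                 ≡⟨ ∏-distrib-* {M} _ _ ⟨
      ∏ (λ v → c v * (n ^ e true v * n ^ e false v))               ≡⟨ ∏-cong {M} pointwise ⟩
      ∏ (λ v → n * (p true ^ e true v * p false ^ e false v))      ≡⟨ ∏-distrib-* {M} (λ _ → n) _ ⟩
      ∏ {M} (λ _ → n) * ∏ (λ v → p true ^ e true v * p false ^ e false v) ≡⟨ cong₂ _*_ (sym (∏-const M n)) (as-∏ p) ⟨
      n ^ M * (p true ^ count true X * p false ^ count false X)    ∎
      where
      open ≡-Reasoning
      p = #admits σ
      c : Fin M → ℕ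
      c v = sum (compatible σ v)
      e : Bool → Fin M → ℕ
      e s v = ⟦ X v ∧ does (side v ≟ᵇ s) ⟧
      as-∏ : ∀ (x : Bool → ℕ) → x true ^ count true X * x false ^ count false X ≡ ∏ (λ v → x true ^ e true v * x false ^ e false v)
      as-∏ x = trans (cong₂ _*_ (sym (∏-^ (x true) (e true))) (sym (∏-^ (x false) (e false)))) (sym (∏-distrib-* {M} _ _))
      pointwise : ∀ v → c v * (n ^ e true v * n ^ e false v) ≡ n * (p true ^ e true v * p false ^ e false v)
      pointwise v with X v | side v
      ... | false | _ = cong (_* 1) (trans (sum-const n 1) (*-identityʳ n))
      ... | true  | true  = swap (p true) n
        where
        swap : ∀ a b → a * (b * 1 * 1) ≡ b * (a * 1 * 1)
        swap = solve-∀
      ... | true  | false = swap (p false) n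
        where
        swap : ∀ a b → a * (1 * (b * 1)) ≡ b * (1 * (a * 1))
        swap = solve-∀

    -- After exchanging the sums over hash functions and labellings, all 3^n labellings obey one
    -- common bound. On average a round multiplies 4^size by at most (3/4)^n.
    ∑rem-bound : ∀ i → 2 ^ i ≤ count true X → 2 ^ i ≤ count false X →
                 4 ^ (2 ^ i) * ∑ᶠ {2 ^ i} M (λ h → 4 ^ size (rem h X)) ≤ (2 ^ i) ^ M * (3 ^ (2 ^ i) * 4 ^ size X)
    ∑rem-bound i n≤a n≤b = *-cancelʳ-≤ _ _ (16 ^ N) {{m^n≢0 16 N}} (begin
      4 ^ N * S * 16 ^ N                                                  ≡⟨ r₁ (4 ^ N) S (16 ^ N) ⟩
      4 ^ N * (16 ^ N * S)                                                ≡⟨ cong (4 ^ N *_) (*-distribˡ-∑ᶠ M (16 ^ N) _) ⟩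
      4 ^ N * ∑ᶠ M (λ h → 16 ^ N * 4 ^ size (rem h X))                    ≤⟨ *-monoʳ-≤ (4 ^ N) (∑ᶠ-mono M (λ h → ≤-trans (≤-reflexive (*-comm (16 ^ N) _)) (rem≤∑weight h))) ⟩
      4 ^ N * ∑ᶠ M (λ h → 4 ^ size X * ∑ᶠ N (weight h))                   ≡⟨ cong (4 ^ N *_) (*-distribˡ-∑ᶠ M (4 ^ size X) _) ⟨
      4 ^ N * (4 ^ size X * ∑ᶠ M (λ h → ∑ᶠ N (weight h)))                 ≡⟨ cong (λ e → 4 ^ N * (4 ^ size X * e)) (∑ᶠ-comm M N weight) ⟩
      4 ^ N * (4 ^ size X * ∑ᶠ N (λ σ → ∑ᶠ M (λ h → weight h σ)))         ≡⟨ r₂ (4 ^ N) (4 ^ size X) _ ⟩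
      4 ^ size X * (4 ^ N * ∑ᶠ N (λ σ → ∑ᶠ M (λ h → weight h σ)))         ≡⟨ cong (4 ^ size X *_) (*-distribˡ-∑ᶠ N (4 ^ N) _) ⟩
      4 ^ size X * ∑ᶠ N (λ σ → 4 ^ N * ∑ᶠ M (λ h → weight h σ))           ≤⟨ *-monoʳ-≤ (4 ^ size X) (∑ᶠ-mono N per-label) ⟩
      4 ^ size X * ∑ᶠ {3} N (λ σ → N ^ M * 16 ^ N)                        ≡⟨ cong (4 ^ size X *_) (∑ᶠ-const N 3 _) ⟩
      4 ^ size X * (3 ^ N * (N ^ M * 16 ^ N))                             ≡⟨ r₃ (4 ^ size X) (3 ^ N) (N ^ M) (16 ^ N) ⟩
      N ^ M * (3 ^ N * 4 ^ size X) * 16 ^ N                               ∎)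
      where
      open ≤-Reasoning
      N = 2 ^ i
      S = ∑ᶠ {N} M (λ h → 4 ^ size (rem h X))
      r₁ : ∀ x y z → x * y * z ≡ x * (z * y)
      r₁ = solve-∀
      r₂ : ∀ x y z → x * (y * z) ≡ y * (x * z)
      r₂ = solve-∀
      r₃ : ∀ s t u v → s * (t * (u * v)) ≡ u * (t * s) * v
      r₃ = solve-∀
      r₄ : ∀ y x c → c * (y * x) ≡ y * (c * x)
      r₄ = solve-∀
      per-label : ∀ σ → 4 ^ N * ∑ᶠ M (λ h → weight h σ) ≤ N ^ M * 16 ^ N
      per-label σ = begin
        4 ^ N * ∑ᶠ M (λ h → weight h σ)                     ≡⟨ cong (4 ^ N *_) (*-distribˡ-∑ᶠ M (∏cost σ) _) ⟨
        4 ^ N * (∏cost σ * ∑ᶠ M (λ h → ∏ (λ v → compatible σ v (h v)))) ≡⟨ cong (λ e → 4 ^ N * (∏cost σ * e)) (∑ᶠ-∏ M (compatible σ)) ⟩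
        4 ^ N * (∏cost σ * ∏ (λ v → sum (compatible σ v)))  ≡⟨ r₂ (4 ^ N) (∏cost σ) _ ⟩
        -- The factor 16^k lost here, with k = `#both σ`, is what `∏cost σ` lacks to 16^n, so the
        -- dependence on σ disappears.
        ∏cost σ * (4 ^ N * ∏ (λ v → sum (compatible σ v)))  ≤⟨ *-monoʳ-≤ (∏cost σ) (compatible-bound i {N = N ^ M} n≤a n≤b (sum-indicator≤ (λ b → admits (σ b) true)) (sum-indicator≤ (λ b → admits (σ b) false)) (#admits-sum σ) (∏-sum-compatible σ)) ⟩
        ∏cost σ * (N ^ M * 16 ^ #both σ)                    ≡⟨ r₄ (N ^ M) (16 ^ #both σ) (∏cost σ) ⟩
        N ^ M * (∏cost σ * 16 ^ #both σ)                    ≡⟨ cong (N ^ M *_) (∏cost-#both σ) ⟩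
        N ^ M * 16 ^ N                                      ∎

-- Choosing the hash functions

total : (A → ℕ) → List A → ℕ
total f xs = sumˡ (map f xs)

total-∘ : ∀ (f : B → ℕ) (g : A → B) xs → total f (map g xs) ≡ total (f ∘ g) xs
total-∘ f g xs = cong sumˡ (sym (map-∘ xs))

total-++ : ∀ (f : A → ℕ) xs ys → total f (xs ++ ys) ≡ total f xs + total f ys
total-++ f xs ys = trans (cong sumˡ (map-++ f xs ys)) (sum-++ (map f xs) (map f ys))

total-mono : {f g : A → ℕ} → (∀ x → f x ≤ g x) → ∀ xs → total f xs ≤ total g xs
total-mono f≤g []       = z≤n
total-mono f≤g (x ∷ xs) = +-mono-≤ (f≤g x) (total-mono f≤g xs)

*-distribˡ-total : ∀ c (f : A → ℕ) xs → c * total f xs ≡ total (λ x → c * f x) xs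
*-distribˡ-total c f []       = *-zeroʳ c
*-distribˡ-total c f (x ∷ xs) = trans (*-distribˡ-+ c (f x) _) (cong (c * f x +_) (*-distribˡ-total c f xs))

term≤total : ∀ (f : A → ℕ) {x xs} → x ∈ xs → f x ≤ total f xs
term≤total f (here refl) = m≤m+n _ _
term≤total f (there x∈)  = ≤-trans (term≤total f x∈) (m≤n+m _ _)

-- The sets with at most `k` elements, each up to pointwise equality: the states over which the
-- union bound runs.
subsets : ∀ m → ℕ → List (Subset m)
subsets zero    k       = (λ ()) ∷ []
subsets (suc m) zero    = (λ _ → false) ∷ []
subsets (suc m) (suc k) = map (false ◂_) (subsets m (suc k)) ++ map (true ◂_) (subsets m k)

size≡0 : ∀ {m} (X : Subset m) → size X ≡ 0 → ∀ v → X v ≡ false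
size≡0 X eq v with X v in Xv
... | false = refl
... | true  = contradiction (≤-trans (≤-reflexive (sym (cong ⟦_⟧ Xv))) (≤-trans (term≤sum (⟦_⟧ ∘ X) v) (≤-reflexive eq))) λ ()

subsets-complete : ∀ m k (X : Subset m) → size X ≤ k → ∃ λ Y → Y ∈ subsets m k × Y ≗ X
subsets-complete zero    k       X _ = _ , here refl , λ ()
subsets-complete (suc m) zero    X p = _ , here refl , λ v → sym (size≡0 X (n≤0⇒n≡0 p) v)
subsets-complete (suc m) (suc k) X p with X zero in X₀
... | false with subsets-complete m (suc k) (tail X) p
...   | Y , Y∈ , Y≗ = false ◂ Y , ∈-++⁺ˡ (∈-map⁺ (false ◂_) Y∈) , λ { zero → sym X₀ ; (suc v) → Y≗ v }
subsets-complete (suc m) (suc k) X (s≤s p) | true with subsets-complete m k (tail X) p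
...   | Y , Y∈ , Y≗ = true ◂ Y , ∈-++⁺ʳ _ (∈-map⁺ (true ◂_) Y∈) , λ { zero → sym X₀ ; (suc v) → Y≗ v }

-- The total is the sum of C(m,j) 4^j over j ≤ k. Splitting on the first element is Pascal's rule,
-- where containing it costs a factor 4.
total-subsets : ∀ m k → total (λ X → 4 ^ size X) (subsets m k) ≤ (4 * suc m) ^ k
total-subsets zero    k    = m^n>0 4 k
total-subsets (suc m) zero = ≤-reflexive (trans (+-identityʳ _) (cong (4 ^_) (trans (sum-const m 0) (*-zeroʳ m))))
total-subsets (suc m) (suc k) = begin
  total f (subsets (suc m) (suc k))                                              ≡⟨ total-++ f (map (false ◂_) (subsets m (suc k))) _ ⟩
  total f (map (false ◂_) (subsets m (suc k))) + total f (map (true ◂_) (subsets m k))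
    ≡⟨ cong₂ _+_ (total-∘ f (false ◂_) (subsets m (suc k))) (trans (total-∘ f (true ◂_) (subsets m k)) (sym (*-distribˡ-total 4 g (subsets m k)))) ⟩
  total g (subsets m (suc k)) + 4 * total g (subsets m k)                        ≤⟨ +-mono-≤ (total-subsets m (suc k)) (*-monoʳ-≤ 4 (total-subsets m k)) ⟩
  (4 * suc m) * (4 * suc m) ^ k + 4 * (4 * suc m) ^ k                            ≡⟨ rearrange m ((4 * suc m) ^ k) ⟩
  (4 * suc (suc m)) * (4 * suc m) ^ k                                            ≤⟨ *-monoʳ-≤ (4 * suc (suc m)) (^-monoˡ-≤ k (*-monoʳ-≤ 4 (n≤1+n (suc m)))) ⟩
  (4 * suc (suc m)) ^ suc k                                                      ∎
  where
  open ≤-Reasoning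
  f : Subset (suc m) → ℕ
  f X = 4 ^ size X
  g : Subset m → ℕ
  g X = 4 ^ size X
  rearrange : ∀ m x → (4 * suc m) * x + 4 * x ≡ (4 * suc (suc m)) * x
  rearrange = solve-∀

^-comm-exp : ∀ x a b → (x ^ a) ^ b ≡ (x ^ b) ^ a
^-comm-exp x a b = trans (^-*-assoc x a b) (trans (cong (x ^_) (*-comm a b)) (sym (^-*-assoc x b a)))

module Phases {M : ℕ} (side : Fin M → Bool) where

  open Matching side
  open Counting side

  Alive : ℕ → Subset M → Set
  Alive n X = n ≤ count true X × n ≤ count false X

  alive? : ∀ n X → Dec (Alive n X)
  alive? n X = (n ≤? count true X) ×-dec (n ≤? count false X)

  -- The contraction holds only while both sides have n elements. Dead states count 0 and never
  -- revive, because counts only decrease.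
  potential : ℕ → Subset M → ℕ
  potential n X = if does (alive? n X) then 4 ^ size X else 0

  potential≤ : ∀ n X → potential n X ≤ 4 ^ size X
  potential≤ n X with does (alive? n X)
  ... | true  = ≤-refl
  ... | false = z≤n

  alive⇒potential : ∀ {n X} → Alive n X → potential n X ≡ 4 ^ size X
  alive⇒potential {n} {X} alive rewrite dec-true (alive? n X) alive = refl

  alive⇒potential>0 : ∀ {n X} → Alive n X → 0 < potential n X
  alive⇒potential>0 {n} {X} alive = subst (0 <_) (sym (alive⇒potential alive)) (m^n>0 4 (size X))

  dead⇒potential≡0 : ∀ {n X} → ¬ Alive n X → potential n X ≡ 0
  dead⇒potential≡0 {n} {X} dead rewrite dec-false (alive? n X) dead = refl

  count-rem≤ : ∀ {n} (h : Fin M → Fin n) X s → count s (rem h X) ≤ count s X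
  count-rem≤ h X s = ≤-trans (m≤m+n _ _) (≤-reflexive (sym (count-rem h X s)))

  ∑potential-bound : ∀ i X → 4 ^ (2 ^ i) * ∑ᶠ {2 ^ i} M (λ h → potential (2 ^ i) (rem h X)) ≤
                             (2 ^ i) ^ M * (3 ^ (2 ^ i) * potential (2 ^ i) X)
  ∑potential-bound i X with alive? (2 ^ i) X
  ... | yes (n≤a , n≤b) = ≤-trans (*-monoʳ-≤ (4 ^ (2 ^ i)) (∑ᶠ-mono M (λ h → potential≤ (2 ^ i) (rem h X))))
    (≤-trans (∑rem-bound X i n≤a n≤b) (≤-reflexive (cong (λ e → (2 ^ i) ^ M * (3 ^ (2 ^ i) * e)) (sym (alive⇒potential (n≤a , n≤b))))))
  ... | no dead = ≤-trans (≤-reflexive (begin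
    4 ^ N * ∑ᶠ M (λ h → potential N (rem h X))  ≡⟨ cong (4 ^ N *_) (∑ᶠ-cong M still-dead) ⟩
    4 ^ N * ∑ᶠ {N} M (λ h → 0)                  ≡⟨ cong (4 ^ N *_) (trans (∑ᶠ-const M N 0) (*-zeroʳ (N ^ M))) ⟩
    4 ^ N * 0                                   ≡⟨ *-zeroʳ (4 ^ N) ⟩
    0                                           ∎)) z≤n
    where
    open ≡-Reasoning
    N = 2 ^ i
    still-dead : ∀ h → potential N (rem h X) ≡ 0
    still-dead h = dead⇒potential≡0 λ (n≤a , n≤b) → dead (≤-trans n≤a (count-rem≤ h X true) , ≤-trans n≤b (count-rem≤ h X false))

  ∑total-bound : ∀ i Xs → 4 ^ (2 ^ i) * ∑ᶠ {2 ^ i} M (λ h → total (potential (2 ^ i) ∘ rem h) Xs) ≤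
                          (2 ^ i) ^ M * (3 ^ (2 ^ i) * total (potential (2 ^ i)) Xs)
  ∑total-bound i [] = ≤-trans (≤-reflexive (trans (cong (4 ^ (2 ^ i) *_) (trans (∑ᶠ-const M (2 ^ i) 0) (*-zeroʳ ((2 ^ i) ^ M)))) (*-zeroʳ (4 ^ (2 ^ i))))) z≤n
  ∑total-bound i (X ∷ Xs) = begin
    4 ^ N * ∑ᶠ M (λ h → potential N (rem h X) + total (potential N ∘ rem h) Xs)         ≡⟨ cong (4 ^ N *_) (∑ᶠ-distrib-+ M _ _) ⟩
    4 ^ N * (∑ᶠ M (λ h → potential N (rem h X)) + ∑ᶠ M (λ h → total (potential N ∘ rem h) Xs)) ≡⟨ *-distribˡ-+ (4 ^ N) _ _ ⟩
    4 ^ N * ∑ᶠ M (λ h → potential N (rem h X)) + 4 ^ N * ∑ᶠ M (λ h → total (potential N ∘ rem h) Xs) ≤⟨ +-mono-≤ (∑potential-bound i X) (∑total-bound i Xs) ⟩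
    N ^ M * (3 ^ N * potential N X) + N ^ M * (3 ^ N * total (potential N) Xs)          ≡⟨ rearrange (N ^ M) (3 ^ N) _ _ ⟩
    N ^ M * (3 ^ N * (potential N X + total (potential N) Xs))                          ∎
    where
    open ≤-Reasoning
    N = 2 ^ i
    rearrange : ∀ u v x y → u * (v * x) + u * (v * y) ≡ u * (v * (x + y))
    rearrange = solve-∀

  -- Averaging the total rather than single potentials gives one hash function that serves the whole
  -- list.
  good-hash : ∀ i Xs → ∃ λ (h : Fin M → Fin (2 ^ i)) →
              4 ^ (2 ^ i) * total (potential (2 ^ i) ∘ rem h) Xs ≤ 3 ^ (2 ^ i) * total (potential (2 ^ i)) Xs
  good-hash i Xs with averageᶠ M (m^n>0 2 i) (λ h → total (potential (2 ^ i) ∘ rem h) Xs)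
  ... | h , avg = h , *-cancelˡ-≤ (N ^ M) {{m^n≢0 N M {{m^n≢0 2 i}}}} (begin
    N ^ M * (4 ^ N * T)     ≡⟨ rearrange (N ^ M) (4 ^ N) T ⟩
    4 ^ N * (N ^ M * T)     ≤⟨ *-monoʳ-≤ (4 ^ N) avg ⟩
    4 ^ N * ∑ᶠ M (λ h → total (potential N ∘ rem h) Xs) ≤⟨ ∑total-bound i Xs ⟩
    N ^ M * (3 ^ N * total (potential N) Xs)            ∎)
    where
    open ≤-Reasoning
    N = 2 ^ i
    T = total (potential N ∘ rem h) Xs
    rearrange : ∀ x y z → x * (y * z) ≡ y * (x * z)
    rearrange = solve-∀

  good-rounds : ∀ i R Xs → ∃ λ hs → length hs ≡ R ×
                (4 ^ (2 ^ i)) ^ R * total (potential (2 ^ i) ∘ run hs) Xs ≤ (3 ^ (2 ^ i)) ^ R * total (potential (2 ^ i)) Xs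
  good-rounds i zero    Xs = [] , refl , ≤-refl
  good-rounds i (suc R) Xs =
    let h , h-good        = good-hash i Xs
        hs , len , hs-good = good-rounds i R (map (rem h) Xs)
    in (2 ^ i , h) ∷ hs , cong suc len , step h hs h-good
         (subst₂ (λ x y → (4 ^ N) ^ R * x ≤ (3 ^ N) ^ R * y)
                 (total-∘ (potential N ∘ run hs) (rem h) Xs) (total-∘ (potential N) (rem h) Xs) hs-good)
    where
    N = 2 ^ i
    step : ∀ (h : Fin M → Fin N) hs → 4 ^ N * total (potential N ∘ rem h) Xs ≤ 3 ^ N * total (potential N) Xs →
           (4 ^ N) ^ R * total (potential N ∘ run hs ∘ rem h) Xs ≤ (3 ^ N) ^ R * total (potential N ∘ rem h) Xs →
           4 ^ N * (4 ^ N) ^ R * total (potential N ∘ run hs ∘ rem h) Xs ≤ 3 ^ N * (3 ^ N) ^ R * total (potential N) Xs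
    step h hs h-good hs-good = begin
      4 ^ N * (4 ^ N) ^ R * T₂      ≡⟨ *-assoc (4 ^ N) ((4 ^ N) ^ R) T₂ ⟩
      4 ^ N * ((4 ^ N) ^ R * T₂)    ≤⟨ *-monoʳ-≤ (4 ^ N) hs-good ⟩
      4 ^ N * ((3 ^ N) ^ R * T₁)    ≡⟨ swap (4 ^ N) ((3 ^ N) ^ R) T₁ ⟩
      (3 ^ N) ^ R * (4 ^ N * T₁)    ≤⟨ *-monoʳ-≤ ((3 ^ N) ^ R) h-good ⟩
      (3 ^ N) ^ R * (3 ^ N * T₀)    ≡⟨ regroup ((3 ^ N) ^ R) (3 ^ N) T₀ ⟩
      3 ^ N * (3 ^ N) ^ R * T₀      ∎
      where
      open ≤-Reasoning
      T₀ = total (potential N) Xs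
      T₁ = total (potential N ∘ rem h) Xs
      T₂ = total (potential N ∘ run hs ∘ rem h) Xs
      swap : ∀ x y z → x * (y * z) ≡ y * (x * z)
      swap = solve-∀
      regroup : ∀ x y z → x * (y * z) ≡ y * x * z
      regroup = solve-∀

  -- A surviving state would contribute at least 1 to the final potential. All the quantities
  -- compared are nth powers, so the hypothesis on `R` does not mention n.
  phase : ∀ i R → 3 ^ R * (4 * suc M) ^ 4 < 4 ^ R →
          ∃ λ hs → length hs ≡ R × (∀ X → size X ≤ 4 * 2 ^ i → ¬ Alive (2 ^ i) (run hs X))
  phase i R large with good-rounds i R (subsets M (4 * 2 ^ i))
  ... | hs , len , good = hs , len , dead
    where
    N = 2 ^ i
    Xs = subsets M (4 * N)
    dead : ∀ X → size X ≤ 4 * N → ¬ Alive N (run hs X)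
    dead X small (n≤a , n≤b) with subsets-complete M (4 * N) X small
    ... | Y , Y∈ , Y≗X = <-irrefl refl (begin-strict
      (4 ^ N) ^ R                                              ≡⟨ *-identityʳ _ ⟨
      (4 ^ N) ^ R * 1                                          ≤⟨ *-monoʳ-≤ ((4 ^ N) ^ R) (≤-trans (alive⇒potential>0 alive-Y) (term≤total (potential N ∘ run hs) Y∈)) ⟩
      (4 ^ N) ^ R * total (potential N ∘ run hs) Xs            ≤⟨ good ⟩
      (3 ^ N) ^ R * total (potential N) Xs                     ≤⟨ *-monoʳ-≤ ((3 ^ N) ^ R) (≤-trans (total-mono (potential≤ N) Xs) (total-subsets M (4 * N))) ⟩
      (3 ^ N) ^ R * (4 * suc M) ^ (4 * N)                      ≡⟨ cong₂ _*_ (^-comm-exp 3 N R) (sym (^-*-assoc (4 * suc M) 4 N)) ⟩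
      (3 ^ R) ^ N * ((4 * suc M) ^ 4) ^ N                      ≡⟨ ^-distribʳ-* (3 ^ R) _ N ⟨
      (3 ^ R * (4 * suc M) ^ 4) ^ N                            <⟨ ^-monoˡ-< N {{m^n≢0 2 i}} large ⟩
      (4 ^ R) ^ N                                              ≡⟨ ^-comm-exp 4 R N ⟩
      (4 ^ N) ^ R                                              ∎)
      where
      open ≤-Reasoning
      transport : ∀ s → N ≤ count s (run hs X) → N ≤ count s (run hs Y)
      transport s p = ≤-trans p (≤-reflexive (count-cong (run-cong hs (λ v → sym (Y≗X v))) s))
      alive-Y : Alive N (run hs Y)
      alive-Y = transport true n≤a , transport false n≤b

  -- A phase only guarantees that some side falls below n; balance extends this to both.
  Balanced : Subset M → Set
  Balanced X = count true X ≡ count false X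

  rem-balanced : ∀ {n} (h : Fin M → Fin n) X → Balanced X → Balanced (rem h X)
  rem-balanced h X bal = +-cancelʳ-≡ (#matched h X) _ _ (trans (sym (count-rem h X true)) (trans bal (count-rem h X false)))

  run-balanced : ∀ hs X → Balanced X → Balanced (run hs X)
  run-balanced []             X bal = bal
  run-balanced ((_ , h) ∷ hs) X bal = run-balanced hs (rem h X) (rem-balanced h X bal)

  run-++ : ∀ hs hs′ X → run (hs ++ hs′) X ≡ run hs′ (run hs X)
  run-++ []             hs′ X = refl
  run-++ ((_ , h) ∷ hs) hs′ X = run-++ hs hs′ (rem h X)

  dead-count : ∀ {n} X → Balanced X → ¬ Alive n X → count true X < n
  dead-count X bal dead = ≰⇒> λ n≤a → dead (n≤a , subst (_ ≤_) bal n≤a)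

  balanced-size : ∀ X → Balanced X → size X ≡ 2 * count true X
  balanced-size X bal = trans (size≡count+count X) (cong (count true X +_) (trans (sym bal) (sym (+-identityʳ _))))

  -- A phase with 2^(i+1) bins leaves each side below 2^(i+1), hence at most 4 * 2^i elements, as
  -- the next phase requires. At i = 0, fewer than one element per side means none.
  all-matched : ∀ R → 3 ^ R * (4 * suc M) ^ 4 < 4 ^ R → ∀ i →
                ∃ λ hs → length hs ≡ suc i * R ×
                (∀ X → Balanced X → size X ≤ 4 * 2 ^ i → ∀ v → run hs X v ≡ false)
  all-matched R large zero with phase zero R large
  ... | hs , len , dead = hs , trans len (sym (+-identityʳ R)) , λ X bal small → size≡0 _ (empty X bal small)
    where
    empty : ∀ X → Balanced X → size X ≤ 4 → size (run hs X) ≡ 0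
    empty X bal small = trans (balanced-size Y bal-Y) (cong (2 *_) (n<1⇒n≡0 (dead-count Y bal-Y (dead X small))))
      where
      Y = run hs X
      bal-Y = run-balanced hs X bal
  all-matched R large (suc i) with phase (suc i) R large | all-matched R large i
  ... | hs , len , dead | hs′ , len′ , empty =
    hs ++ hs′ , trans (length-++ hs) (cong₂ _+_ len len′) ,
    λ X bal small v → trans (cong (λ Y → Y v) (run-++ hs hs′ X)) (empty _ (run-balanced hs X bal) (halved X bal small) v)
    where
    halved : ∀ X → Balanced X → size X ≤ 4 * 2 ^ suc i → size (run hs X) ≤ 4 * 2 ^ i
    halved X bal small = begin
      size Y             ≡⟨ balanced-size Y bal-Y ⟩
      2 * count true Y   ≤⟨ *-monoʳ-≤ 2 (<⇒≤ (dead-count Y bal-Y (dead X small))) ⟩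
      2 * (2 * 2 ^ i)    ≡⟨ *-assoc 2 2 (2 ^ i) ⟨
      4 * 2 ^ i          ∎
      where
      open ≤-Reasoning
      Y = run hs X
      bal-Y = run-balanced hs X bal

-- Assignments from matchings

countFin≡sum : ∀ n {P : Fin n → Set} (P? : ∀ i → Dec (P i)) → countFin n P? ≡ sum (λ i → ⟦ does (P? i) ⟧)
countFin≡sum zero    P? = refl
countFin≡sum (suc n) P? with P? zero | countFin≡sum n (λ i → P? (suc i))
... | yes _ | ih = cong suc ih
... | no  _ | ih = ih

sum-split : ∀ a {b} (f : Fin (a + b) → ℕ) → sum f ≡ sum (λ i → f (i ↑ˡ b)) + sum (λ j → f (a ↑ʳ j))
sum-split zero    f = refl
sum-split (suc a) f = trans (cong (f zero +_) (sum-split a (tail f))) (sym (+-assoc (f zero) _ _))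

sum-combine : ∀ a {b} (f : Fin (a * b) → ℕ) → sum f ≡ sum (λ i → sum (λ j → f (combine {a} i j)))
sum-combine zero        f = refl
sum-combine (suc a) {b} f = trans (sum-split b f) (cong (sum (λ j → f (j ↑ˡ (a * b))) +_) (sum-combine a (λ c → f (b ↑ʳ c))))

sum-<ᵇ : ∀ {n m} → m ≤ n → sum {n} (λ k → ⟦ toℕ k <ᵇ m ⟧) ≡ m
sum-<ᵇ {n} z≤n       = trans (sum-const n 0) (*-zeroʳ n)
sum-<ᵇ     (s≤s m≤n) = cong suc (sum-<ᵇ m≤n)

sum≡1 : ∀ {n} (f : Fin n → ℕ) → sum f ≡ 1 → ∃ λ i → f i ≡ 1 × (∀ j → j ≢ i → f j ≡ 0)
sum≡1 {suc n} f eq with f zero in f₀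
... | 1 = zero , f₀ , others
  where
  others : ∀ j → j ≢ zero → f j ≡ 0
  others zero    j≢0 = contradiction refl j≢0
  others (suc j) _   = n≤0⇒n≡0 (≤-trans (term≤sum (tail f) j) (≤-reflexive (ℕ.suc-injective eq)))
... | 0 with sum≡1 (tail f) eq
...   | i , fi , others = suc i , fi , λ { zero _ → f₀ ; (suc j) j≢i → others j (j≢i ∘ cong suc) }

does-≟-injective : ∀ {m n} (g : Fin m → Fin n) → Injective _≡_ _≡_ g → ∀ a b → does (g a ≟ g b) ≡ does (a ≟ b)
does-≟-injective g inj a b with a ≟ b
... | yes refl = dec-true (g a ≟ g a) refl
... | no a≢b   = dec-false (g a ≟ g b) (a≢b ∘ inj)

does-≟-sym : ∀ {n} (a b : Fin n) → does (a ≟ b) ≡ does (b ≟ a)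
does-≟-sym a b with b ≟ a
... | yes refl = dec-true (a ≟ a) refl
... | no b≢a   = dec-false (a ≟ b) (b≢a ∘ sym)

hit-just : ∀ {n} (v : Fin n) → hit (just v) v ≡ true
hit-just v = dec-true (v ≟ v) refl

<ᵇ-suc : ∀ k m → k ≢ m → (k <ᵇ m) ≡ (k <ᵇ m + 1)
<ᵇ-suc zero    zero    k≢m = contradiction refl k≢m
<ᵇ-suc zero    (suc m) _   = refl
<ᵇ-suc (suc k) zero    _   = refl
<ᵇ-suc (suc k) (suc m) k≢m = <ᵇ-suc k m (k≢m ∘ cong suc)

+∸-comm : ∀ m n → m + (n ∸ m) ≡ n + (m ∸ n)
+∸-comm m n with ≤-total m n
... | inj₁ m≤n = trans (m+[n∸m]≡n m≤n) (sym (trans (cong (n +_) (m≤n⇒m∸n≡0 m≤n)) (+-identityʳ n)))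
... | inj₂ n≤m = trans (trans (cong (m +_) (m≤n⇒m∸n≡0 n≤m)) (+-identityʳ m)) (sym (m+[n∸m]≡n n≤m))

-- Elements of side `true` are the w workers; those of side `false` are the tickets (j , k) with
-- j a task and k < w, of which a multiset of multiplicities m owns those with k < m j.
module Assign (w t : ℕ) (default : Fin t) where

  M : ℕ
  M = w + t * w

  worker : Fin w → Fin M
  worker i = i ↑ˡ (t * w)

  ticket : Fin (t * w) → Fin M
  ticket c = w ↑ʳ c

  task : Fin (t * w) → Fin t
  task c = proj₁ (remQuot w c)

  side : Fin M → Bool
  side v = [ const true , const false ]′ (splitAt w v)

  owned : (Fin t → ℕ) → Fin (t * w) → Bool
  owned m c = toℕ (proj₂ (remQuot {t} w c)) <ᵇ m (task c)

  state : (Fin t → ℕ) → Subset M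
  state m v = [ const true , owned m ]′ (splitAt w v)

  taskOf : Fin M → Fin t
  taskOf v = [ const default , task ]′ (splitAt w v)

  open Matching side
  open Counting side
  open Phases side

  side-worker : ∀ i → side (worker i) ≡ true
  side-worker i = cong [ const true , const false ]′ (splitAt-↑ˡ w i (t * w))

  side-ticket : ∀ c → side (ticket c) ≡ false
  side-ticket c = cong [ const true , const false ]′ (splitAt-↑ʳ w (t * w) c)

  side-true : ∀ {v} → side v ≡ true → ∃ λ i → v ≡ worker i
  side-true {v} eq with splitAt w v in v-eq
  ... | inj₁ i = i , sym (splitAt⁻¹-↑ˡ v-eq)

  side-false : ∀ {v} → side v ≡ false → ∃ λ c → v ≡ ticket c
  side-false {v} eq with splitAt w v in v-eq
  ... | inj₂ c = c , sym (splitAt⁻¹-↑ʳ v-eq)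

  state-worker : ∀ m i → state m (worker i) ≡ true
  state-worker m i = cong [ const true , owned m ]′ (splitAt-↑ˡ w i (t * w))

  state-ticket : ∀ m c → state m (ticket c) ≡ owned m c
  state-ticket m c = cong [ const true , owned m ]′ (splitAt-↑ʳ w (t * w) c)

  taskOf-ticket : ∀ c → taskOf (ticket c) ≡ task c
  taskOf-ticket c = cong [ const default , task ]′ (splitAt-↑ʳ w (t * w) c)

  state-cong : ∀ {m m′} → m ≗ m′ → state m ≗ state m′
  state-cong m≗m′ v with splitAt w v
  ... | inj₁ i = refl
  ... | inj₂ c = cong (toℕ (proj₂ (remQuot {t} w c)) <ᵇ_) (m≗m′ (task c))

  sum-owned : ∀ m → (∀ j → m j ≤ w) → ∀ (p : Fin t → Bool) →
              sum (λ c → ⟦ p (task c) ∧ owned m c ⟧) ≡ sum (λ j → ⟦ p j ⟧ * m j)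
  sum-owned m m≤w p = trans (sum-combine t _) (sum-cong-≗ {t} per-task)
    where
    per-task : ∀ j → sum (λ k → ⟦ p (task (combine {t} j k)) ∧ owned m (combine j k) ⟧) ≡ ⟦ p j ⟧ * m j
    per-task j = trans (sum-cong-≗ {w} (λ k → cong (λ jk → ⟦ p (proj₁ jk) ∧ (toℕ (proj₂ jk) <ᵇ m (proj₁ jk)) ⟧) (remQuot-combine {t} j k))) (by-cases (p j))
      where
      by-cases : ∀ b → sum {w} (λ k → ⟦ b ∧ (toℕ k <ᵇ m j) ⟧) ≡ ⟦ b ⟧ * m j
      by-cases true  = trans (sum-<ᵇ (m≤w j)) (sym (+-identityʳ (m j)))
      by-cases false = trans (sum-const w 0) (*-zeroʳ w)

  module _ (m : Fin t → ℕ) (m-sum : sum m ≡ w) where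

    m≤w : ∀ j → m j ≤ w
    m≤w j = ≤-trans (term≤sum m j) (≤-reflexive m-sum)

    count-workers : count true (state m) ≡ w
    count-workers = begin
      count true (state m)       ≡⟨ sum-split w _ ⟩
      sum (λ i → e (worker i)) + sum (λ c → e (ticket c)) ≡⟨ cong₂ _+_ (sum-cong-≗ {w} on-worker) (sum-cong-≗ {t * w} on-ticket) ⟩
      sum {w} (λ i → 1) + sum {t * w} (λ c → 0)           ≡⟨ cong₂ _+_ (trans (sum-const w 1) (*-identityʳ w)) (trans (sum-const (t * w) 0) (*-zeroʳ (t * w))) ⟩
      w + 0                      ≡⟨ +-identityʳ w ⟩
      w                          ∎
      where
      open ≡-Reasoning
      e : Fin M → ℕ
      e v = ⟦ state m v ∧ does (side v ≟ᵇ true) ⟧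
      on-worker : ∀ i → e (worker i) ≡ 1
      on-worker i rewrite state-worker m i | side-worker i = refl
      on-ticket : ∀ c → e (ticket c) ≡ 0
      on-ticket c rewrite side-ticket c = cong ⟦_⟧ (∧-zeroʳ _)

    count-tickets : count false (state m) ≡ w
    count-tickets = begin
      count false (state m)      ≡⟨ sum-split w _ ⟩
      sum (λ i → e (worker i)) + sum (λ c → e (ticket c)) ≡⟨ cong₂ _+_ (sum-cong-≗ {w} on-worker) (sum-cong-≗ {t * w} on-ticket) ⟩
      sum {w} (λ i → 0) + sum (λ c → ⟦ true ∧ owned m c ⟧) ≡⟨ cong₂ _+_ (trans (sum-const w 0) (*-zeroʳ w)) (sum-owned m m≤w (λ _ → true)) ⟩
      sum (λ j → 1 * m j)        ≡⟨ sum-cong-≗ {t} (λ j → *-identityˡ (m j)) ⟩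
      sum m                      ≡⟨ m-sum ⟩
      w                          ∎
      where
      open ≡-Reasoning
      e : Fin M → ℕ
      e v = ⟦ state m v ∧ does (side v ≟ᵇ false) ⟧
      on-worker : ∀ i → e (worker i) ≡ 0
      on-worker i rewrite side-worker i = cong ⟦_⟧ (∧-zeroʳ _)
      on-ticket : ∀ c → e (ticket c) ≡ ⟦ owned m c ⟧
      on-ticket c rewrite state-ticket m c | side-ticket c = cong ⟦_⟧ (∧-identityʳ _)

    state-balanced : Balanced (state m)
    state-balanced = trans count-workers (sym count-tickets)

    state-size : size (state m) ≡ 2 * w
    state-size = trans (balanced-size (state m) state-balanced) (cong (2 *_) count-workers)

  -- `m j + (m′ j ∸ m j)` is the pointwise maximum, the common neighbour of two adjacent multisets.
  -- It may own w + 1 tickets; stability does not ask for balance.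
  one-more : ∀ (m m′ : Fin t → ℕ) → (∀ j → m′ j ≤ w) → sum (λ j → m′ j ∸ m j) ≡ 1 →
             ∃ λ u → AgreeOff u (state m) (state (λ j → m j + (m′ j ∸ m j)))
  one-more m m′ m′≤w eq with sum≡1 _ eq
  -- Copies are numbered from 0, so the new ticket has number `m j₀`; it exists because
  -- `m j₀ < m′ j₀ ≤ w`.
  ... | j₀ , one , zeros = ticket (combine j₀ (fromℕ< m<w)) , agree
    where
    m<w : m j₀ < w
    m<w = ≤-trans (m∸n≢0⇒n<m (λ z → contradiction (trans (sym one) z) λ ())) (m′≤w j₀)
    agree : AgreeOff (ticket (combine j₀ (fromℕ< m<w))) (state m) (state (λ j → m j + (m′ j ∸ m j)))
    agree v v≢u with splitAt w v in v-eq
    ... | inj₁ _ = refl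
    ... | inj₂ c with task c ≟ j₀
    ...   | no j≢j₀ = cong (toℕ (proj₂ (remQuot {t} w c)) <ᵇ_) (sym (trans (cong (m (task c) +_) (zeros (task c) j≢j₀)) (+-identityʳ _)))
    ...   | yes refl = trans (<ᵇ-suc (toℕ k) (m (task c)) k≢m) (cong (λ e → toℕ k <ᵇ m (task c) + e) (sym one))
      where
      k = proj₂ (remQuot {t} w c)
      k≢m : toℕ k ≢ m (task c)
      k≢m k≡m = v≢u (trans (sym (splitAt⁻¹-↑ʳ v-eq)) (cong ticket (trans (sym (combine-remQuot {t} w c)) (cong (combine (task c)) (toℕ-injective (trans k≡m (sym (toℕ-fromℕ< m<w))))))))

  worker-count≤ : ∀ (p : Fin w → Bool) es → (∀ i → worker i ∉ es → p i ≡ false) → sum (λ i → ⟦ p i ⟧) ≤ length es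
  worker-count≤ p []       out = ≤-reflexive (trans (sum-cong-≗ {w} (λ i → cong ⟦_⟧ (out i λ ()))) (trans (sum-const w 0) (*-zeroʳ w)))
  worker-count≤ p (e ∷ es) out = begin
    sum (λ i → ⟦ p i ⟧)                                   ≤⟨ sum-mono (λ i → cases (p i) (does (e ≟ worker i))) ⟩
    sum (λ i → ⟦ does (e ≟ worker i) ⟧ * 1 + ⟦ not (does (e ≟ worker i)) ∧ p i ⟧) ≡⟨ ∑-distrib-+ {w} _ _ ⟩
    sum (λ i → ⟦ does (e ≟ worker i) ⟧ * 1) + sum (λ i → ⟦ not (does (e ≟ worker i)) ∧ p i ⟧)
      ≤⟨ +-mono-≤ (≤-trans (m≤m+n _ _) (≤-reflexive (trans (sym (sum-split w (λ v → ⟦ does (e ≟ v) ⟧ * 1))) (sum-δ e (λ _ → 1)))))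
                  (worker-count≤ _ es out′) ⟩
    suc (length es)                                       ∎
    where
    open ≤-Reasoning
    cases : ∀ x y → ⟦ x ⟧ ≤ ⟦ y ⟧ * 1 + ⟦ not y ∧ x ⟧
    cases true  true  = ≤-refl
    cases true  false = ≤-refl
    cases false _     = z≤n
    out′ : ∀ i → worker i ∉ es → not (does (e ≟ worker i)) ∧ p i ≡ false
    out′ i i∉es with e ≟ worker i
    ... | yes _  = refl
    ... | no e≢i = out i λ { (here eq) → e≢i (sym eq) ; (there i∈es) → i∉es i∈es }

  module _ (hs : List Round) where

    -- Once the rounds match every element, `worker-matched` rules out the default task.
    assigned : (Fin t → ℕ) → Fin w → Fin t
    assigned m i = maybe taskOf default (match hs (state m) (worker i))

    hit-match-sym : ∀ X u v → hit (match hs X u) v ≡ hit (match hs X v) u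
    hit-match-sym X u v with hit (match hs X u) v in eq | hit (match hs X v) u in eq′
    ... | true  | true  = refl
    ... | false | false = refl
    ... | true  | false = contradiction (trans (sym eq′) (trans (cong (λ y → hit y u) (proj₁ (match-sym hs X (hit-true _ eq)))) (hit-just u))) λ ()
    ... | false | true  = contradiction (trans (sym eq) (trans (cong (λ y → hit y v) (proj₁ (match-sym hs X (hit-true _ eq′)))) (hit-just v))) λ ()

    module _ (m : Fin t → ℕ) (m-sum : sum m ≡ w) (done : ∀ v → run hs (state m) v ≡ false) where

      matching : Fin M → Maybe (Fin M)
      matching = match hs (state m)

      worker-matched : ∀ i → ∃ λ c → matching (worker i) ≡ just (ticket c)
      worker-matched i with match-total hs (state m) (state-worker m i) (done (worker i))
      ... | y , eq with side-false (trans (proj₂ (proj₂ (match-sym hs (state m) eq))) (cong not (side-worker i)))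
      ...   | c , refl = c , eq

      sum-per-worker : ∀ (p : Fin t → Bool) i →
                       sum (λ c → ⟦ hit (matching (worker i)) (ticket c) ∧ p (task c) ⟧) ≡ ⟦ p (assigned m i) ⟧
      sum-per-worker p i with matching (worker i) | worker-matched i
      ... | _ | c , refl = trans (sum-cong-≗ {t * w} (λ c′ → cong (λ b → ⟦ b ∧ p (task c′) ⟧) (does-≟-injective ticket (↑ʳ-injective w _ _) c c′)))
                                 (trans (sum-pick c (p ∘ task)) (cong (λ j → ⟦ p j ⟧) (sym (taskOf-ticket c))))

      sum-per-ticket : ∀ (p : Fin t → Bool) c →
                       sum (λ i → ⟦ hit (matching (worker i)) (ticket c) ∧ p (task c) ⟧) ≡ ⟦ p (task c) ∧ owned m c ⟧
      sum-per-ticket p c = trans (sum-cong-≗ {w} (λ i → cong (λ b → ⟦ b ∧ p (task c) ⟧) (hit-match-sym (state m) (worker i) (ticket c)))) by-match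
        where
        by-match : sum (λ i → ⟦ hit (matching (ticket c)) (worker i) ∧ p (task c) ⟧) ≡ ⟦ p (task c) ∧ owned m c ⟧
        by-match with matching (ticket c) in eq
        ... | nothing = trans (trans (sum-const w 0) (*-zeroʳ w)) (sym (trans (cong (λ b → ⟦ p (task c) ∧ b ⟧) unowned) (cong ⟦_⟧ (∧-zeroʳ _))))
          where
          unowned : owned m c ≡ false
          unowned with owned m c in own
          ... | false = refl
          ... | true with match-total hs (state m) (trans (state-ticket m c) own) (done (ticket c))
          ...   | y , eq′ = contradiction (trans (sym eq) eq′) λ ()
        ... | just y with match-sym hs (state m) eq
        ...   | _ , own , sy with side-true (trans sy (cong not (side-ticket c)))
        ...     | i , refl = trans (sum-cong-≗ {w} (λ i′ → cong (λ b → ⟦ b ∧ p (task c) ⟧) (does-≟-injective worker (↑ˡ-injective (t * w) _ _) i i′)))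
                                   (trans (sum-pick i (λ _ → p (task c)))
                                          (cong ⟦_⟧ (sym (trans (cong (p (task c) ∧_) (trans (sym (state-ticket m c)) own)) (∧-identityʳ _)))))

      -- Double counting of matched pairs whose ticket has task `j`: each worker lies in one pair,
      -- and a ticket lies in one exactly if it is owned.
      assigned-count : ∀ j → countFin w (λ i → assigned m i ≟ j) ≡ m j
      assigned-count j = begin
        countFin w (λ i → assigned m i ≟ j)                      ≡⟨ countFin≡sum w _ ⟩
        sum (λ i → ⟦ does (assigned m i ≟ j) ⟧)                  ≡⟨ sum-cong-≗ {w} (λ i → cong ⟦_⟧ (does-≟-sym (assigned m i) j)) ⟩
        sum (λ i → ⟦ does (j ≟ assigned m i) ⟧)                  ≡⟨ sum-cong-≗ {w} (sum-per-worker (λ j′ → does (j ≟ j′))) ⟨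
        sum (λ i → sum (λ c → ⟦ hit (matching (worker i)) (ticket c) ∧ does (j ≟ task c) ⟧)) ≡⟨ ∑-comm {w} {t * w} _ ⟩
        sum (λ c → sum (λ i → ⟦ hit (matching (worker i)) (ticket c) ∧ does (j ≟ task c) ⟧)) ≡⟨ sum-cong-≗ {t * w} (sum-per-ticket (λ j′ → does (j ≟ j′))) ⟩
        sum (λ c → ⟦ does (j ≟ task c) ∧ owned m c ⟧)            ≡⟨ sum-owned m (m≤w m m-sum) (λ j′ → does (j ≟ j′)) ⟩
        sum (λ j′ → ⟦ does (j ≟ j′) ⟧ * m j′)                    ≡⟨ sum-δ j m ⟩
        m j                                                      ∎
        where open ≡-Reasoning

    -- Both states are compared with that of the pointwise maximum, one ticket away from each, so 3
    -- changes per round are paid twice.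
    assigned-stable : ∀ (m m′ : Fin t → ℕ) → sum m ≡ w → sum m′ ≡ w → sum (λ j → m j ∸ m′ j) ≡ 1 → sum (λ j → m′ j ∸ m j) ≡ 1 →
                      sum (λ i → ⟦ not (does (assigned m i ≟ assigned m′ i)) ⟧) ≤ 6 * length hs
    assigned-stable m m′ m-sum m′-sum d d′ with one-more m m′ (m≤w m′ m′-sum) d′ | one-more m′ m (m≤w m m-sum) d
    ... | _ , near | _ , near′
        with match-stable hs near
           | match-stable hs (λ v v≢u → trans (near′ v v≢u) (state-cong (λ j → +∸-comm (m′ j) (m j)) v))
    ...   | es , len , same | es′ , len′ , same′ = begin
      sum (λ i → ⟦ not (does (assigned m i ≟ assigned m′ i)) ⟧)   ≤⟨ worker-count≤ _ (es ++ es′) unchanged ⟩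
      length (es ++ es′)                                          ≡⟨ length-++ es ⟩
      length es + length es′                                      ≡⟨ cong₂ _+_ len len′ ⟩
      3 * length hs + 3 * length hs                               ≡⟨ *-distribʳ-+ (length hs) 3 3 ⟨
      6 * length hs                                               ∎
      where
      open ≤-Reasoning
      unchanged : ∀ i → worker i ∉ es ++ es′ → not (does (assigned m i ≟ assigned m′ i)) ≡ false
      unchanged i i∉ = cong not (dec-true (assigned m i ≟ assigned m′ i) (cong (maybe taskOf default)
        (trans (same (worker i) (i∉ ∘ ∈-++⁺ˡ)) (sym (same′ (worker i) (i∉ ∘ ∈-++⁺ʳ es))))))

-- The number of rounds and the final constant

n<2^suc⌊log₂n⌋ : ∀ n → n < 2 ^ suc ⌊log₂ n ⌋
n<2^suc⌊log₂n⌋ n = ≰⇒> λ 2^≤n → <-irrefl refl (≤-trans (≤-reflexive (sym (⌊log₂[2^n]⌋≡n (suc ⌊log₂ n ⌋)))) (⌊log₂⌋-mono-≤ 2^≤n))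

-- Three rounds gain 64/27 > 2, so 3q rounds gain more than 2^q. With ℓ = ⌊log₂ (w * t)⌋, four times
-- the number of elements plus one is below 2^(ℓ+4), and its fourth power is below 2^(4ℓ+16) ≤
-- 2^(20ℓ) as ℓ ≥ 1.
enough-rounds : ∀ w t → 2 ≤ w → 2 ≤ t →
                3 ^ (3 * (20 * ⌊log₂ (w * t) ⌋)) * (4 * suc (w + t * w)) ^ 4 < 4 ^ (3 * (20 * ⌊log₂ (w * t) ⌋))
enough-rounds w t 2≤w 2≤t = begin-strict
  3 ^ (3 * q) * (4 * suc (w + t * w)) ^ 4   <⟨ *-monoʳ-< (3 ^ (3 * q)) {{m^n≢0 3 (3 * q)}} few ⟩
  3 ^ (3 * q) * 2 ^ q                       ≡⟨ cong (_* 2 ^ q) (^-*-assoc 3 3 q) ⟨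
  27 ^ q * 2 ^ q                            ≡⟨ ^-distribʳ-* 27 2 q ⟨
  54 ^ q                                    ≤⟨ ^-monoˡ-≤ q (m≤m+n 54 10) ⟩
  64 ^ q                                    ≡⟨ ^-*-assoc 4 3 q ⟩
  4 ^ (3 * q)                               ∎
  where
  open ≤-Reasoning
  ℓ = ⌊log₂ (w * t) ⌋
  q = 20 * ℓ
  0<ℓ : 0 < ℓ
  0<ℓ = ⌊log₂⌋-mono-≤ {2} (≤-trans (m≤m+n 2 2) (*-mono-≤ 2≤w 2≤t))
  elements≤ : suc (w + t * w) ≤ 2 * (w * t)
  elements≤ = begin
    suc (w + t * w)       ≤⟨ +-monoˡ-≤ (t * w) (≤-trans (+-monoˡ-≤ w (<⇒≤ 2≤w)) (≤-trans (≤-reflexive (cong (w +_) (sym (+-identityʳ w)))) (*-monoˡ-≤ w 2≤t))) ⟩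
    t * w + t * w         ≡⟨ rearrange w t ⟩
    2 * (w * t)           ∎
    where
    rearrange : ∀ w t → t * w + t * w ≡ 2 * (w * t)
    rearrange = solve-∀
  few : (4 * suc (w + t * w)) ^ 4 < 2 ^ q
  few = begin-strict
    (4 * suc (w + t * w)) ^ 4     <⟨ ^-monoˡ-< 4 (*-monoʳ-< 4 (≤-<-trans elements≤ (*-monoʳ-< 2 (n<2^suc⌊log₂n⌋ (w * t))))) ⟩
    (4 * (2 * 2 ^ suc ℓ)) ^ 4     ≡⟨ cong (_^ 4) (*-assoc 2 2 (2 * 2 ^ suc ℓ)) ⟩
    (2 ^ (4 + ℓ)) ^ 4             ≡⟨ ^-*-assoc 2 (4 + ℓ) 4 ⟩
    2 ^ ((4 + ℓ) * 4)             ≤⟨ ^-monoʳ-≤ 2 exponent≤ ⟩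
    2 ^ q                         ∎
    where
    exponent≤ : (4 + ℓ) * 4 ≤ 20 * ℓ
    exponent≤ = begin
      (4 + ℓ) * 4       ≡⟨ expand ℓ ⟩
      16 * 1 + 4 * ℓ    ≤⟨ +-monoˡ-≤ (4 * ℓ) (*-monoʳ-≤ 16 0<ℓ) ⟩
      16 * ℓ + 4 * ℓ    ≡⟨ *-distribʳ-+ ℓ 16 4 ⟨
      20 * ℓ            ∎
      where
      expand : ∀ ℓ → (4 + ℓ) * 4 ≡ 16 * 1 + 4 * ℓ
      expand = solve-∀

theorem1 : Σ ℕ (λ C → (C > 0) × ((w t : ℕ) → 2 ≤ w → 2 ≤ t →
    Σ (WTAFunction w t) (λ φ →
    SwitchingCostAtMost φ (C * ⌊log₂ w ⌋ * ⌊log₂ (w * t) ⌋))))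
theorem1 = 720 , s≤s z≤n , construct
  where
  construct : ∀ w t → 2 ≤ w → 2 ≤ t → Σ (WTAFunction w t) λ φ → SwitchingCostAtMost φ (720 * ⌊log₂ w ⌋ * ⌊log₂ (w * t) ⌋)
  -- Matching on `t` provides the task `zero` as the default.
  construct w t@(suc _) 2≤w 2≤t = φ , cost-bound
    where
    open Assign w t zero
    open Phases side
    L = ⌊log₂ w ⌋
    ℓ = ⌊log₂ (w * t) ⌋
    R = 3 * (20 * ℓ)
    scheme = all-matched R (enough-rounds w t 2≤w 2≤t) L
    hs = proj₁ scheme
    sum-mult : (T : TaskMultiset w t) → sum (mult T) ≡ w
    sum-mult (m , m-sum) = trans (sym (sumFin≡sum t m)) m-sum
    diff-sum : (T₁ T₂ : TaskMultiset w t) → diffSize T₁ T₂ ≡ 1 → sum (λ j → mult T₁ j ∸ mult T₂ j) ≡ 1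
    diff-sum T₁ T₂ d = trans (sym (sumFin≡sum t (λ j → mult T₁ j ∸ mult T₂ j))) d
    small : ∀ (T : TaskMultiset w t) → size (state (mult T)) ≤ 4 * 2 ^ L
    small T = begin
      size (state (mult T))  ≡⟨ state-size (mult T) (sum-mult T) ⟩
      2 * w                  ≤⟨ *-monoʳ-≤ 2 (<⇒≤ (n<2^suc⌊log₂n⌋ w)) ⟩
      2 * (2 * 2 ^ L)        ≡⟨ *-assoc 2 2 (2 ^ L) ⟨
      4 * 2 ^ L              ∎
      where open ≤-Reasoning
    φ : WTAFunction w t
    φ T = assigned hs (mult T)
        , assigned-count hs (mult T) (sum-mult T) (proj₂ (proj₂ scheme) (state (mult T)) (state-balanced (mult T) (sum-mult T)) (small T))
    cost-bound : SwitchingCostAtMost φ (720 * L * ℓ)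
    cost-bound T₁ T₂ (d₁₂ , d₂₁) = begin
      switches φ T₁ T₂                  ≡⟨ countFin≡sum w _ ⟩
      _                                 ≤⟨ assigned-stable hs (mult T₁) (mult T₂) (sum-mult T₁) (sum-mult T₂)
                                             (diff-sum T₁ T₂ d₁₂) (diff-sum T₂ T₁ d₂₁) ⟩
      6 * length hs                     ≡⟨ cong (6 *_) (proj₁ (proj₂ scheme)) ⟩
      -- As L ≥ 1, there are L + 1 ≤ 2L phases of 60ℓ rounds with 6 changes each: 6 * 2 * 60 = 720.
      6 * (suc L * R)                   ≤⟨ *-monoʳ-≤ 6 (*-monoˡ-≤ R (+-monoˡ-≤ L 0<L)) ⟩
      6 * ((L + L) * R)                 ≡⟨ collect L ℓ ⟩
      720 * L * ℓ                       ∎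
      where
      open ≤-Reasoning
      0<L : 0 < L
      0<L = ⌊log₂⌋-mono-≤ {2} 2≤w
      collect : ∀ L ℓ → 6 * ((L + L) * (3 * (20 * ℓ))) ≡ 720 * L * ℓ
      collect = solve-∀
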